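{- Let $n\ge d$ be positive integers, $L=\{\ell_1,\dots,\ell_n\}$, $R=\{r_1,\dots,r_d\}$. Then: (i) if $\mathcal M$ is a linkage $(n,d)$-matching field on $L\sqcup R$, then the set of maximal topes on $L\sqcup R$ that are compatible with every matching of $\mathcal M$ is an $(n,d)$-tope arrangement; (ii) if $\mathcal A$ is an $(n,d)$-tope arrangement, then for each $d$-subset $\sigma\subseteq L$ there is exactly one perfect matching on $\sigma\sqcup R$ that is contained in some tope of $\mathcal A$, and these matchings form a linkage $(n,d)$-matching field.
   Context: Bipartite graphs on $L\sqcup R$ are identified with their edge sets. Left (right) degree vectors list the degrees of $\ell_1,\dots,\ell_n$ (of $r_1,\dots,r_d$); $e_A$ is the characteristic vector of $A$. A tope is a bipartite graph on $L\sqcup R$ whose left degree vector is $e_\sigma$ for some $\sigma\subseteq L$ and whose right degree vector has all entries positive. It is maximal if $\sigma=L$. Two forests $F_1,F_2$ on $L\sqcup R$ are compatible if, whenever $J\subseteq L$, $I\subseteq R$ are such that both $F_1$ and $F_2$ contain perfect matchings on $J\sqcup I$, those perfect matchings are equal. An $(n,d)$-matching field $\mathcal M=(M_\sigma)$ assigns to each $d$-subset $\sigma\subseteq L$ a perfect matching $M_\sigma$ on $\sigma\sqcup R$. It is linkage if for every $(d+1)$-subset $\tau\subseteq L$ the union of the matchings $M_\sigma$, $\sigma\subset\tau$, $|\sigma|=d$, is a tree on $\tau\sqcup R$. An $(n,d)$-tope arrangement is a set of pairwise compatible maximal topes such that the map sending a tope with right degree vector $v$ to $v-e_{[d]}$ is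 a bijection onto $\{w\in\mathbb Z_{\ge0}^d:\sum w_i=n-d\}$. -}

module Defs where

open import Data.Nat using (ℕ; zero; suc; _≤_; _<_; _∸_)
open import Data.Bool using (Bool; true; false; if_then_else_)
open import Data.Fin using (Fin)
open import Data.Fin.Subset using (Subset; _∈_; _⊆_; ∣_∣) renaming (⊤ to Full)
open import Data.Vec using (Vec; lookup; map; tabulate; replicate)
open import Data.List using (List; []; _∷_; length; [_]; _++_)
open import Data.List.Relation.Unary.Unique.Propositional using (Unique)
open import Data.Sum using (_⊎_; inj₁; inj₂)
open import Data.Product using (Σ; ∃; _×_; _,_)
open import Data.Empty using (⊥)
open import Relation.Binary.PropositionalEquality using (_≡_)

-- Bipartite graphs on L ⊔ R with L = Fin n (ℓ₁..ℓₙ), R = Fin d (r₁..r_d),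
-- identified with their edge sets: row i is the set of right
-- neighbours of ℓᵢ.

Graph : ℕ → ℕ → Set
Graph n d = Vec (Subset d) n

Edge : ∀ {n d} → Graph n d → Fin n → Fin d → Set
Edge G i j = j ∈ lookup G i

_⊆G_ : ∀ {n d} → Graph n d → Graph n d → Set
G ⊆G H = ∀ i j → Edge G i j → Edge H i j

ldeg : ∀ {n d} → Graph n d → Fin n → ℕ
ldeg G i = ∣ lookup G i ∣

rdeg : ∀ {n d} → Graph n d → Fin d → ℕ
rdeg G j = ∣ map (λ row → lookup row j) G ∣

ldegVec : ∀ {n d} → Graph n d → Vec ℕ n
ldegVec {n} G = tabulate (ldeg G)

rdegVec : ∀ {n d} → Graph n d → Vec ℕ d
rdegVec {d = d} G = tabulate (rdeg G)

charVec : ∀ {m} → Subset m → Vec ℕ m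
charVec A = map (λ b → if b then 1 else 0) A

IsTopeWith : ∀ {n d} → Graph n d → Subset n → Set
IsTopeWith G σ = (ldegVec G ≡ charVec σ) × (∀ j → 0 < rdeg G j)

IsTope : ∀ {n d} → Graph n d → Set
IsTope {n} G = Σ (Subset n) (IsTopeWith G)

IsMaximalTope : ∀ {n d} → Graph n d → Set
IsMaximalTope G = IsTopeWith G Full

IsPerfectMatchingOn : ∀ {n d} → Graph n d → Subset n → Subset d → Set
IsPerfectMatchingOn M J I =
  (∀ i j → Edge M i j → (i ∈ J) × (j ∈ I)) ×
  (∀ i → i ∈ J → ldeg M i ≡ 1) ×
  (∀ j → j ∈ I → rdeg M j ≡ 1)

ContainsPMOn : ∀ {n d} → Graph n d → Graph n d → Subset n → Subset d → Set
ContainsPMOn F M J I = IsPerfectMatchingOn M J I × (M ⊆G F)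

-- compatibility (used only for forests: topes and matchings)
Compatible : ∀ {n d} → Graph n d → Graph n d → Set
Compatible {n} {d} F₁ F₂ =
  ∀ (J : Subset n) (I : Subset d) (M₁ M₂ : Graph n d) →
  ContainsPMOn F₁ M₁ J I → ContainsPMOn F₂ M₂ J I → M₁ ≡ M₂

-- Graph theory on edge relations (needed for unions of matchings)

ERel : ℕ → ℕ → Set₁
ERel n d = Fin n → Fin d → Set

Vertex : ℕ → ℕ → Set
Vertex n d = Fin n ⊎ Fin d

Adj : ∀ {n d} → ERel n d → Vertex n d → Vertex n d → Set
Adj E (inj₁ i) (inj₂ j) = E i j
Adj E (inj₂ j) (inj₁ i) = E i j
Adj E (inj₁ _) (inj₁ _) = ⊥
Adj E (inj₂ _) (inj₂ _) = ⊥

data Reach {n d} (E : ERel n d) : Vertex n d → Vertex n d → Set where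
  here : ∀ {u} → Reach E u u
  step : ∀ {u w v} → Adj E u w → Reach E w v → Reach E u v

data Chain {n d} (E : ERel n d) : List (Vertex n d) → Set where
  nil  : Chain E []
  one  : ∀ {v} → Chain E (v ∷ [])
  cons : ∀ {u w vs} → Adj E u w → Chain E (w ∷ vs) → Chain E (u ∷ w ∷ vs)

HasCycle : ∀ {n d} → ERel n d → Set
HasCycle {n} {d} E =
  Σ (Vertex n d) λ v → Σ (List (Vertex n d)) λ vs →
    (2 ≤ length vs) × Unique (v ∷ vs) × Chain E (v ∷ vs ++ [ v ])

InVS : ∀ {n d} → Subset n → Subset d → Vertex n d → Set
InVS J I (inj₁ i) = i ∈ J
InVS J I (inj₂ j) = j ∈ I

IsTreeOn : ∀ {n d} → ERel n d → Subset n → Subset d → Set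
IsTreeOn {n} {d} E J I =
  (∀ i j → E i j → (i ∈ J) × (j ∈ I)) ×
  (∀ u v → InVS J I u → InVS J I v → Reach E u v) ×
  (HasCycle E → ⊥)

-- Matching fields. A matching field is encoded as a function on all
-- subsets of L; only its values on d-subsets matter.

IsMatchingField : ∀ {n d} → (Subset n → Graph n d) → Set
IsMatchingField {n} {d} 𝓜 =
  ∀ (σ : Subset n) → ∣ σ ∣ ≡ d → IsPerfectMatchingOn (𝓜 σ) σ Full

UnionBelow : ∀ {n d} → (Subset n → Graph n d) → Subset n → ERel n d
UnionBelow {n} {d} 𝓜 τ i j =
  Σ (Subset n) λ σ → (σ ⊆ τ) × (∣ σ ∣ ≡ d) × Edge (𝓜 σ) i j

IsLinkage : ∀ {n d} → (Subset n → Graph n d) → Set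
IsLinkage {n} {d} 𝓜 =
  ∀ (τ : Subset n) → ∣ τ ∣ ≡ suc d → IsTreeOn (UnionBelow 𝓜 τ) τ Full

IsLinkageMatchingField : ∀ {n d} → (Subset n → Graph n d) → Set
IsLinkageMatchingField 𝓜 = IsMatchingField 𝓜 × IsLinkage 𝓜

sumVec : ∀ {m} → Vec ℕ m → ℕ
sumVec v = Data.Vec.sum v

minusOnes : ∀ {m} → Vec ℕ m → Vec ℕ m
minusOnes v = map (λ x → x ∸ 1) v

IsTopeArrangement : ∀ (n d : ℕ) → (Graph n d → Set) → Set
IsTopeArrangement n d 𝓐 =
  (∀ T → 𝓐 T → IsMaximalTope T) ×
  (∀ T T′ → 𝓐 T → 𝓐 T′ → Compatible T T′) ×
  (∀ T → 𝓐 T → sumVec (minusOnes (rdegVec T)) ≡ n ∸ d) ×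
  (∀ T T′ → 𝓐 T → 𝓐 T′ →
     minusOnes (rdegVec T) ≡ minusOnes (rdegVec T′) → T ≡ T′) ×
  (∀ (w : Vec ℕ d) → sumVec w ≡ n ∸ d →
     Σ (Graph n d) λ T → 𝓐 T × (minusOnes (rdegVec T) ≡ w))

CompatibleTopes : ∀ {n d} → (Subset n → Graph n d) → Graph n d → Set
CompatibleTopes {n} {d} 𝓜 T =
  IsMaximalTope T × (∀ (σ : Subset n) → ∣ σ ∣ ≡ d → Compatible T (𝓜 σ))

InArrangementPM : ∀ {n d} → (Graph n d → Set) → Subset n → Graph n d → Set
InArrangementPM {n} {d} 𝓐 σ M =
  IsPerfectMatchingOn M σ Full × Σ (Graph n d) λ T → 𝓐 T × (M ⊆G T)

{-# OPTIONS --safe #-}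

-- A maximal tope is a map L → R and a matching on σ ⊔ R is a bijection σ → R.
--
-- (i) Call a tope t on K ⊆ L good if M_σ = t|σ for every transversal σ ⊆ K of its fibres.
-- If |u| = |K| - 1, then the good topes of type u on the sets K ∖ x are the orientations,
-- towards x, of one tree on K ⊔ R; for u = (1,…,1) this is the linkage axiom. Orienting
-- the tree towards r instead gives a good tope of type u + e_r on K. That this amalgamation
-- preserves the tree property rests on the fact that sets of equal size pairwise differing
-- in at most one element have a common core or lie in a common set with one more element.
-- Hence there is exactly one good tope of each type. To see that a good tope t is compatible
-- with M_σ, extend M_σ to a good tope t′ on L, adding new elements only to the fibres over the
-- right nodes where the two differ; such a pair is excluded by descent on the ground set.
--
-- (ii) If f and g are compatible then the digraph of the arcs f z → g z has no cycles but
-- loops. So topes of types u + e_i and u + e_j differ along a path from i to j. Therefore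
-- left nodes can be deleted from an arrangement until only σ is left, and on a (d+1)-set
-- the topes of types (1,…,1) + e_r are the orientations of one tree.

module Submission where

open import Defs
open import Data.Nat using (ℕ; zero; suc; _+_; _∸_; _≤_; _<_; z≤n; s≤s; _≤?_)
open import Data.Nat.Properties hiding (_≟_)
open import Data.Nat.Properties using () renaming (_≟_ to _≟ℕ_)
open import Data.Bool using (if_then_else_)
open import Data.Fin using (Fin; zero; suc; join; splitAt)
open import Data.Fin.Properties using (_≟_; any?; splitAt-join; injective⇒≤)
open import Data.Fin.Subset
  using (Subset; inside; outside; _∈_; _∉_; _⊆_; _-_; ∣_∣; _∪_; _∩_; ⁅_⁆) renaming (⊤ to Full)
open import Data.Fin.Subset.Properties
open import Data.Vec using (Vec; []; _∷_; lookup; tabulate; here; there)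
import Data.Vec as Vec
open import Data.Vec.Properties
  using (lookup∘tabulate; tabulate∘lookup; tabulate-cong; tabulate-∘;
    lookup-map; lookup-replicate; lookup⇒[]=; []=⇒lookup)
open import Data.List using (List; []; _∷_; length; [_]; _++_)
import Data.List as List
open import Data.List.Membership.Propositional using () renaming (_∈_ to _∈ₗ_)
open import Data.List.Membership.Propositional.Properties using (∈-lookup; ∈-++⁺ʳ)
open import Data.List.Relation.Unary.Any using (here; there)
open import Data.List.Relation.Unary.All using (All; []; _∷_)
import Data.List.Relation.Unary.All as All
open import Data.List.Relation.Unary.AllPairs using ([]; _∷_)
open import Data.List.Relation.Unary.Linked using ([-]; _∷_) renaming (Linked to LinkedList)
open import Data.List.Relation.Unary.Linked.Properties using (Linked⇒AllPairs)
open import Data.List.Relation.Unary.Unique.Propositional using () renaming (Unique to UniqueList)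
open import Data.Product using (Σ; ∃; _×_; _,_; proj₁; proj₂)
open import Data.Sum using (_⊎_; inj₁; inj₂; [_,_]′)
open import Data.Sum.Properties using (inj₁-injective; inj₂-injective)
open import Data.Empty using (⊥)
open import Data.Unit using (⊤; tt)
open import Function using (_∘_)
open import Relation.Nullary using (¬_; Dec; yes; no; does; ¬?; contradiction)
open import Relation.Nullary.Decidable using (_×-dec_; decidable-stable; dec-true; dec-false)
open import Relation.Binary.PropositionalEquality hiding ([_]; J)

private variable
  n d : ℕ

-- Subsets and the sizes of fibres

sep : {P : Fin n → Set} → (∀ x → Dec (P x)) → Subset n
sep P? = tabulate (does ∘ P?)

∈-sep⁺ : {P : Fin n → Set} (P? : ∀ x → Dec (P x)) {x : Fin n} → P x → x ∈ sep P?
∈-sep⁺ P? {x} px = lookup⇒[]= x _ (trans (lookup∘tabulate (does ∘ P?) x) (dec-true (P? x) px))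

∈-sep⁻ : {P : Fin n → Set} (P? : ∀ x → Dec (P x)) {x : Fin n} → x ∈ sep P? → P x
∈-sep⁻ P? {x} x∈ with P? x | trans (sym (lookup∘tabulate (does ∘ P?) x)) ([]=⇒lookup x∈)
... | yes px | _ = px
... | no _   | ()

infixl 5 _∖_

abstract
  _∖_ : Subset n → Fin n → Subset n
  p ∖ x = p - x

  ∉∖ : (p : Subset n) (x : Fin n) → x ∉ p ∖ x
  ∉∖ (_ ∷ p) zero ()
  ∉∖ (_ ∷ p) (suc x) (there x∈) = ∉∖ p x x∈

  ∖⊆ : {p : Subset n} {x : Fin n} → p ∖ x ⊆ p
  ∖⊆ {p = p} {x} = p─q⊆p p ⁅ x ⁆

  ∈-∖ : {p : Subset n} {x z : Fin n} → z ∈ p → z ≢ x → z ∈ p ∖ x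
  ∈-∖ {p = p} = x∈p∧x≢y⇒x∈p-y {p = p}

  ∖-comm : (p : Subset n) (x y : Fin n) → p ∖ x ∖ y ≡ p ∖ y ∖ x
  ∖-comm = p─x─y≡p─y─x

  ∣∖∣ : (p : Subset n) {x : Fin n} → x ∈ p → ∣ p ∣ ≡ suc ∣ p ∖ x ∣
  ∣∖∣ (inside ∷ p) here = cong (λ q → suc ∣ q ∣) (sym (p─⊥≡p p))
  ∣∖∣ (inside ∷ p) (there x∈) = cong suc (∣∖∣ p x∈)
  ∣∖∣ (outside ∷ p) (there x∈) = ∣∖∣ p x∈

∈∖⇒≢ : {p : Subset n} {x z : Fin n} → z ∈ p ∖ x → z ≢ x
∈∖⇒≢ {p = p} {x} z∈ refl = ∉∖ p x z∈

∣∖∣-pred : {p : Subset n} {x : Fin n} {k : ℕ} → x ∈ p → ∣ p ∣ ≡ suc k → ∣ p ∖ x ∣ ≡ k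
∣∖∣-pred {p = p} x∈ e = suc-injective (trans (sym (∣∖∣ p x∈)) e)

inhabited : {p : Subset n} → 1 ≤ ∣ p ∣ → ∃ λ x → x ∈ p
inhabited {n} {p} 1≤ with nonempty? p
... | yes ne = ne
... | no em = contradiction (subst (1 ≤_) (trans (cong ∣_∣ (Empty-unique em)) (∣⊥∣≡0 n)) 1≤) λ ()

two-elements : {p : Subset n} → 2 ≤ ∣ p ∣ → ∃ λ x → ∃ λ y → x ∈ p × y ∈ p × y ≢ x
two-elements {p = p} 2≤ with inhabited {p = p} (≤-trans (s≤s z≤n) 2≤)
... | x , x∈ with inhabited {p = p ∖ x} (≤-pred (subst (2 ≤_) (∣∖∣ p x∈) 2≤))
... | y , y∈ = x , y , x∈ , ∖⊆ y∈ , ∈∖⇒≢ y∈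

∈⇒1≤∣∣ : {p : Subset n} {x : Fin n} → x ∈ p → 1 ≤ ∣ p ∣
∈⇒1≤∣∣ {p = p} x∈ = subst (1 ≤_) (sym (∣∖∣ p x∈)) (s≤s z≤n)

2≤∣∣ : {p : Subset n} {x y : Fin n} → x ∈ p → y ∈ p → y ≢ x → 2 ≤ ∣ p ∣
2≤∣∣ {p = p} x∈ y∈ y≢x = subst (2 ≤_) (sym (∣∖∣ p x∈)) (s≤s (∈⇒1≤∣∣ (∈-∖ y∈ y≢x)))

outsider : (p q : Subset n) → ∣ q ∣ < ∣ p ∣ → ∃ λ x → x ∈ p × x ∉ q
outsider p q q<p with any? (λ x → (x ∈? p) ×-dec ¬? (x ∈? q))
... | yes w = w
... | no ¬w = contradiction
  (p⊆q⇒∣p∣≤∣q∣ λ {x} x∈p → decidable-stable (x ∈? q) λ x∉q → ¬w (x , x∈p , x∉q))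
  (<⇒≱ q<p)

-- The set `p` exceeds `f` by one element, and whatever `p` has outside `q` is outside `f` too.
at-most-one-outside : {p q f : Subset n} → f ⊆ p → f ⊆ q → ∣ p ∣ ≡ suc ∣ f ∣ →
  ∀ {a b} → a ∈ p → a ∉ q → b ∈ p → b ∉ q → a ≡ b
at-most-one-outside {p = p} {q} {f} f⊆p f⊆q e {a} {b} a∈p a∉q b∈p b∉q with a ≟ b
... | yes a≡b = a≡b
... | no a≢b = contradiction (≤-reflexive e) (<⇒≱ f<)
  where
  b∈ : b ∈ p ∖ a
  b∈ = ∈-∖ b∈p (a≢b ∘ sym)
  f⊆ : f ⊆ p ∖ a ∖ b
  f⊆ x∈f = ∈-∖ (∈-∖ (f⊆p x∈f) λ { refl → a∉q (f⊆q x∈f) }) λ { refl → b∉q (f⊆q x∈f) }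
  f< : suc ∣ f ∣ < ∣ p ∣
  f< = subst (suc ∣ f ∣ <_) (sym (trans (∣∖∣ p a∈p) (cong suc (∣∖∣ (p ∖ a) b∈))))
    (s≤s (s≤s (p⊆q⇒∣p∣≤∣q∣ f⊆)))

same-size : {p q : Subset n} → p ⊆ q → ∣ p ∣ ≡ ∣ q ∣ → q ⊆ p
same-size {p = p} {q} p⊆q e {x} x∈q = decidable-stable (x ∈? p) λ x∉p →
  <-irrefl e (p⊂q⇒∣p∣<∣q∣ (p⊆q , x , x∈q , x∉p))

abstract
  fibre : Subset n → (Fin n → Fin d) → Fin d → Subset n
  fibre K t r = sep (λ z → (z ∈? K) ×-dec (t z ≟ r))

  ∈-fibre⁺ : {K : Subset n} {t : Fin n → Fin d} {r : Fin d} {z : Fin n} →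
    z ∈ K → t z ≡ r → z ∈ fibre K t r
  ∈-fibre⁺ {K = K} {t} {r} z∈ e = ∈-sep⁺ (λ z → (z ∈? K) ×-dec (t z ≟ r)) (z∈ , e)

  ∈-fibre⁻ : {K : Subset n} {t : Fin n → Fin d} {r : Fin d} {z : Fin n} →
    z ∈ fibre K t r → z ∈ K × t z ≡ r
  ∈-fibre⁻ {K = K} {t} {r} = ∈-sep⁻ (λ z → (z ∈? K) ×-dec (t z ≟ r))

cnt : Subset n → (Fin n → Fin d) → Fin d → ℕ
cnt K t r = ∣ fibre K t r ∣

-- Type vectors

Σ′ : (Fin d → ℕ) → ℕ
Σ′ u = Vec.sum (tabulate u)

Σ′-cong : {u v : Fin d → ℕ} → (∀ s → u s ≡ v s) → Σ′ u ≡ Σ′ v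
Σ′-cong {zero} e = refl
Σ′-cong {suc d} e = cong₂ _+_ (e zero) (Σ′-cong (e ∘ suc))

Σ′-zero : Σ′ {d} (λ _ → 0) ≡ 0
Σ′-zero {zero} = refl
Σ′-zero {suc d} = Σ′-zero {d}

Σ′-one : Σ′ {d} (λ _ → 1) ≡ d
Σ′-one {zero} = refl
Σ′-one {suc d} = cong suc (Σ′-one {d})

Σ′-mono : {u v : Fin d → ℕ} → (∀ s → u s ≤ v s) → Σ′ u ≤ Σ′ v
Σ′-mono {zero} le = z≤n
Σ′-mono {suc d} le = +-mono-≤ (le zero) (Σ′-mono (le ∘ suc))

abstract
  δ : Fin d → Fin d → ℕ
  δ r s = if does (r ≟ s) then 1 else 0

  -- The vector `u` + e_r of the overview.
  bump : (Fin d → ℕ) → Fin d → Fin d → ℕ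
  bump u r s = δ r s + u s

  bump-same : (u : Fin d → ℕ) (r : Fin d) → bump u r r ≡ suc (u r)
  bump-same u r = cong (λ b → (if b then 1 else 0) + u r) (dec-true (r ≟ r) refl)

  bump-other : (u : Fin d → ℕ) {r s : Fin d} → r ≢ s → bump u r s ≡ u s
  bump-other u {r} {s} r≢s = cong (λ b → (if b then 1 else 0) + u s) (dec-false (r ≟ s) r≢s)

  u≤bump : (u : Fin d → ℕ) (r s : Fin d) → u s ≤ bump u r s
  u≤bump u r s = m≤n+m (u s) (δ r s)

  bump-comm : (u : Fin d → ℕ) (r s c : Fin d) → bump (bump u r) s c ≡ bump (bump u s) r c
  bump-comm u r s c = trans (sym (+-assoc (δ s c) (δ r c) (u c)))
    (trans (cong (_+ u c) (+-comm (δ s c) (δ r c))) (+-assoc (δ r c) (δ s c) (u c)))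

  bump-cong : {u v : Fin d → ℕ} → (∀ s → u s ≡ v s) → ∀ r s → bump u r s ≡ bump v r s
  bump-cong e r s = cong (δ r s +_) (e s)

  bump-cancel : {u v : Fin d → ℕ} (r s : Fin d) → bump u r s ≡ bump v r s → u s ≡ v s
  bump-cancel r s = +-cancelˡ-≡ (δ r s) _ _

  unbump : (v : Fin d → ℕ) {r : Fin d} → 2 ≤ v r → (∀ s → 1 ≤ v s) →
    Σ (Fin d → ℕ) λ u → (∀ s → v s ≡ bump u r s) × (∀ s → 1 ≤ u s)
  unbump v {r} 2≤ 1≤ = (λ s → v s ∸ δ r s) , (λ s → sym (m+[n∸m]≡n (δ≤ s))) , pos
    where
    δ≤ : ∀ s → δ r s ≤ v s
    δ≤ s with r ≟ s
    ... | yes _ = 1≤ s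
    ... | no _ = z≤n
    pos : ∀ s → 1 ≤ v s ∸ δ r s
    pos s with r ≟ s
    ... | yes refl = ∸-monoˡ-≤ 1 2≤
    ... | no _ = 1≤ s

  Σ′-bump : (u : Fin d → ℕ) (r : Fin d) → Σ′ (bump u r) ≡ suc (Σ′ u)
  Σ′-bump {suc d} u zero = refl
  Σ′-bump {suc d} u (suc r) = trans
    (cong (u zero +_) (trans (Σ′-cong λ s → cong (_+ u (suc s)) (δ-suc s)) (Σ′-bump (u ∘ suc) r)))
    (+-suc (u zero) _)
    where
    δ-suc : ∀ s → δ (suc r) (suc s) ≡ δ r s
    δ-suc s with r ≟ s
    ... | yes _ = refl
    ... | no _ = refl

cnt-cong : {K : Subset n} {t t′ : Fin n → Fin d} → (∀ {z} → z ∈ K → t z ≡ t′ z) →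
  ∀ r → cnt K t r ≡ cnt K t′ r
cnt-cong {K = K} {t} {t′} e r = cong ∣_∣ (⊆-antisym
  (λ z∈ → let z∈K , tz = ∈-fibre⁻ z∈ in ∈-fibre⁺ z∈K (trans (sym (e z∈K)) tz))
  (λ z∈ → let z∈K , tz = ∈-fibre⁻ z∈ in ∈-fibre⁺ z∈K (trans (e z∈K) tz)))

cnt-del : {K : Subset n} (t : Fin n → Fin d) {x : Fin n} → x ∈ K →
  ∀ r → cnt K t r ≡ bump (cnt (K ∖ x) t) (t x) r
cnt-del {K = K} t {x} x∈ r with t x ≟ r
... | yes refl = trans (∣∖∣ (fibre K t r) (∈-fibre⁺ x∈ refl)) (trans (cong (λ q → suc ∣ q ∣) (⊆-antisym
  (λ z∈ → let z∈K , tz = ∈-fibre⁻ (∖⊆ z∈) in ∈-fibre⁺ (∈-∖ z∈K (∈∖⇒≢ z∈)) tz)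
  (λ z∈ → let z∈K , tz = ∈-fibre⁻ z∈ in ∈-∖ (∈-fibre⁺ (∖⊆ z∈K) tz) (∈∖⇒≢ z∈K))))
  (sym (bump-same (cnt (K ∖ x) t) r)))
... | no tx≢r = trans (cong ∣_∣ (⊆-antisym
  (λ z∈ → let z∈K , tz = ∈-fibre⁻ z∈ in ∈-fibre⁺ (∈-∖ z∈K λ { refl → tx≢r tz }) tz)
  (λ z∈ → let z∈K , tz = ∈-fibre⁻ z∈ in ∈-fibre⁺ (∖⊆ z∈K) tz)))
  (sym (bump-other (cnt (K ∖ x) t) tx≢r))

HasType : Subset n → (Fin n → Fin d) → (Fin d → ℕ) → Set
HasType K t v = ∀ r → cnt K t r ≡ v r

type-del : {K : Subset n} {t : Fin n → Fin d} {u : Fin d → ℕ} {x : Fin n} {q : Fin d} →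
  x ∈ K → t x ≡ q → HasType K t (bump u q) → HasType (K ∖ x) t u
type-del {t = t} {x = x} x∈ refl ty r =
  bump-cancel (t x) r (trans (sym (cnt-del t x∈ r)) (ty r))

type-add : {K : Subset n} {t : Fin n → Fin d} {u : Fin d → ℕ} {x : Fin n} {q : Fin d} →
  x ∈ K → t x ≡ q → HasType (K ∖ x) t u → HasType K t (bump u q)
type-add {t = t} {x = x} x∈ refl ty r = trans (cnt-del t x∈ r) (bump-cong ty (t x) r)

fibre-elt : {K : Subset n} {t : Fin n → Fin d} {r : Fin d} → 1 ≤ cnt K t r →
  ∃ λ z → z ∈ K × t z ≡ r
fibre-elt {K = K} {t} {r} 1≤ with inhabited {p = fibre K t r} 1≤
... | z , z∈ = z , ∈-fibre⁻ z∈

fibre-two : {K : Subset n} {t : Fin n → Fin d} {r : Fin d} → 2 ≤ cnt K t r →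
  ∃ λ x → ∃ λ y → (x ∈ K × t x ≡ r) × (y ∈ K × t y ≡ r) × y ≢ x
fibre-two {K = K} {t} {r} 2≤ with two-elements {p = fibre K t r} 2≤
... | x , y , x∈ , y∈ , y≢x = x , y , ∈-fibre⁻ x∈ , ∈-fibre⁻ y∈ , y≢x

∣K∣≡Σcnt : (K : Subset n) (t : Fin n → Fin d) → ∣ K ∣ ≡ Σ′ (cnt K t)
∣K∣≡Σcnt {n} {d} K t = go ∣ K ∣ K refl
  where
  go : ∀ k (K : Subset n) → ∣ K ∣ ≡ k → k ≡ Σ′ (cnt K t)
  go zero K e = sym (trans (Σ′-cong empty) (Σ′-zero {d}))
    where
    empty : ∀ r → cnt K t r ≡ 0
    empty r = n≤0⇒n≡0 (subst (cnt K t r ≤_) e (p⊆q⇒∣p∣≤∣q∣ (proj₁ ∘ ∈-fibre⁻ {K = K} {t} {r})))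
  go (suc k) K e with inhabited {p = K} (subst (1 ≤_) (sym e) (s≤s z≤n))
  ... | x , x∈ = trans (cong suc (go k (K ∖ x) (∣∖∣-pred x∈ e)))
    (sym (trans (Σ′-cong (cnt-del t x∈)) (Σ′-bump (cnt (K ∖ x) t) (t x))))

∣K∣≡Σ : {K : Subset n} {t : Fin n → Fin d} {v : Fin d → ℕ} → HasType K t v → ∣ K ∣ ≡ Σ′ v
∣K∣≡Σ {K = K} {t} ty = trans (∣K∣≡Σcnt K t) (Σ′-cong ty)

exists-≥2 : (v : Fin d → ℕ) → d < Σ′ v → ∃ λ r → 2 ≤ v r
exists-≥2 {d} v d< with any? (λ r → 2 ≤? v r)
... | yes w = w
... | no ¬w = contradiction
  (≤-trans (Σ′-mono λ s → ≤-pred (≰⇒> (¬w ∘ (s ,_)))) (≤-reflexive (Σ′-one {d}))) (<⇒≱ d<)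

abstract
  -- Its size is the potential that decreases along walks in the trees: `t` runs through
  -- orientations and `g` is the orientation aimed at.
  mismatch : Subset n → (Fin n → Fin d) → (Fin n → Fin d) → Subset n
  mismatch K t g = sep (λ z → (z ∈? K) ×-dec ¬? (t z ≟ g z))

  ∈-mismatch⁺ : {K : Subset n} {t g : Fin n → Fin d} {z : Fin n} → z ∈ K → t z ≢ g z → z ∈ mismatch K t g
  ∈-mismatch⁺ {K = K} {t} {g} z∈ ne = ∈-sep⁺ (λ z → (z ∈? K) ×-dec ¬? (t z ≟ g z)) (z∈ , ne)

  ∈-mismatch⁻ : {K : Subset n} {t g : Fin n → Fin d} {z : Fin n} → z ∈ mismatch K t g → z ∈ K × t z ≢ g z
  ∈-mismatch⁻ {K = K} {t} {g} = ∈-sep⁻ (λ z → (z ∈? K) ×-dec ¬? (t z ≟ g z))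

Σ≡d⇒all-one : (v : Fin d → ℕ) → (∀ s → 1 ≤ v s) → Σ′ v ≡ d → ∀ s → v s ≡ 1
Σ≡d⇒all-one {d} v 1≤ e s with v s ≤? 1
... | yes ≤1 = ≤-antisym ≤1 (1≤ s)
... | no ≰1 with unbump v (≰⇒> ≰1) 1≤
... | u , v≡ , 1≤u = contradiction
  (≤-trans (≤-reflexive (sym (Σ′-one {d}))) (Σ′-mono 1≤u))
  (<⇒≱ (≤-reflexive (trans (sym (trans (Σ′-cong v≡) (Σ′-bump u s))) e)))

insert-∖ : {S : Subset n} {a : Fin n} → a ∉ S → (S ∪ ⁅ a ⁆) ∖ a ≡ S
insert-∖ {S = S} {a} a∉ = ⊆-antisym
  (λ z∈ → [ (λ z∈S → z∈S) , (λ z∈a → contradiction (x∈⁅y⁆⇒x≡y a z∈a) (∈∖⇒≢ z∈)) ]′ (x∈p∪q⁻ S ⁅ a ⁆ (∖⊆ z∈)))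
  (λ z∈ → ∈-∖ (x∈p∪q⁺ (inj₁ z∈)) λ { refl → a∉ z∈ })

inserted : {S : Subset n} (a : Fin n) → a ∈ S ∪ ⁅ a ⁆
inserted a = x∈p∪q⁺ (inj₂ (x∈⁅x⁆ a))

∣insert∣ : {S : Subset n} {a : Fin n} → a ∉ S → ∣ S ∪ ⁅ a ⁆ ∣ ≡ suc ∣ S ∣
∣insert∣ {S = S} {a} a∉ = trans (∣∖∣ (S ∪ ⁅ a ⁆) (inserted a)) (cong (λ R → suc ∣ R ∣) (insert-∖ a∉))

-- Sets of equal size m ≥ 2 that pairwise differ in at most one element have
-- a common core of size m - 1 or a common union of size m + 1; the condition
-- x ∉ E x excludes the former.
module Triangle (K : Subset n) (E : Fin n → Subset n) {size : ℕ} (2≤size : 2 ≤ size)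
  (E⊆K : ∀ {x} → x ∈ K → E x ⊆ K)
  (irr : ∀ {x} → x ∈ K → x ∉ E x)
  (∣E∣ : ∀ {x} → x ∈ K → ∣ E x ∣ ≡ size)
  (close : ∀ {x y} → x ∈ K → y ∈ K → x ≢ y →
    ∀ {a b} → a ∈ E x → a ∉ E y → b ∈ E x → b ∉ E y → a ≡ b)
  {x₀ : Fin n} (x₀∈ : x₀ ∈ K) where

  transfer : ∀ {x y a b} → x ∈ K → y ∈ K → x ≢ y → a ∈ E x → a ∉ E y → b ∈ E x → b ≢ a → b ∈ E y
  transfer {y = y} {b = b} x∈ y∈ x≢y a∈ a∉ b∈ b≢a =
    decidable-stable (b ∈? E y) λ b∉ → b≢a (close x∈ y∈ x≢y b∈ b∉ a∈ a∉)

  -- `B` is `E x₀` with one more element `b`: for `a` in `E x₀`, the set `E a` misses `a` and so has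
  -- some `b` outside `E x₀`. A second element `c` of `E x₀` gives a third set `E c`, which contains
  -- both `a` and `b`.
  union : Σ (Subset n) λ B →
    (∀ {y} → y ∈ K → E y ⊆ B) ×
    (∀ {x} → x ∈ B → x ∈ K × (∀ {p} → p ∈ B → p ≢ x → p ∈ E x))
  union with two-elements {p = E x₀} (subst (2 ≤_) (sym (∣E∣ x₀∈)) 2≤size)
  ... | a , c , a∈ , c∈ , c≢a with outsider (E a) (E x₀ ∖ a)
          (≤-reflexive (trans (sym (∣∖∣ (E x₀) a∈)) (trans (∣E∣ x₀∈) (sym (∣E∣ (E⊆K x₀∈ a∈))))))
  ... | b , b∈ , b∉′ = E x₀ ∪ ⁅ b ⁆ , below , λ x∈ → in-K x∈ , full x∈
    where
    a∈K = E⊆K x₀∈ a∈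
    c∈K = E⊆K x₀∈ c∈
    b∈K = E⊆K a∈K b∈
    a≢b : a ≢ b
    a≢b refl = irr a∈K b∈
    b∉ : b ∉ E x₀
    b∉ b∈₀ = b∉′ (∈-∖ b∈₀ (a≢b ∘ sym))
    x₀≢ : ∀ {z} → z ∈ E x₀ → x₀ ≢ z
    x₀≢ z∈ refl = irr x₀∈ z∈
    ∈B : ∀ {z} → z ∈ E x₀ ⊎ z ≡ b → z ∈ E x₀ ∪ ⁅ b ⁆
    ∈B (inj₁ z∈) = x∈p∪q⁺ (inj₁ z∈)
    ∈B (inj₂ refl) = x∈p∪q⁺ (inj₂ (x∈⁅x⁆ b))
    B∋ : ∀ {z} → z ∈ E x₀ ∪ ⁅ b ⁆ → z ∈ E x₀ ⊎ z ≡ b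
    B∋ z∈ with x∈p∪q⁻ (E x₀) ⁅ b ⁆ z∈
    ... | inj₁ z∈₀ = inj₁ z∈₀
    ... | inj₂ z∈b = inj₂ (x∈⁅y⁆⇒x≡y b z∈b)
    toA : ∀ {z} → z ∈ E x₀ → z ≢ a → z ∈ E a
    toA = transfer x₀∈ a∈K (x₀≢ a∈) a∈ (irr a∈K)
    fromA : ∀ {z} → z ∈ E a → z ≢ b → z ∈ E x₀
    fromA = transfer a∈K x₀∈ (x₀≢ a∈ ∘ sym) b∈ b∉
    c≢b : c ≢ b
    c≢b refl = b∉ c∈
    a∈Ec : a ∈ E c
    a∈Ec = transfer x₀∈ c∈K (x₀≢ c∈) c∈ (irr c∈K) a∈ (c≢a ∘ sym)
    b∈Ec : b ∈ E c
    b∈Ec = transfer a∈K c∈K (c≢a ∘ sym) (toA c∈ c≢a) (irr c∈K) b∈ (c≢b ∘ sym)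

    -- An `e` in `E y` outside `B` is the only element by which `E y` exceeds `E x₀` and `E a`.
    -- Hence `E y` contains neither `b` nor `a`, whereas `E c` contains both and may exceed `E y` by
    -- one element only.
    below : ∀ {y} → y ∈ K → E y ⊆ E x₀ ∪ ⁅ b ⁆
    below {y} y∈ {e} e∈ with e ∈? E x₀ | e ≟ b
    ... | yes e∈₀ | _ = ∈B (inj₁ e∈₀)
    ... | no _ | yes e≡b = ∈B (inj₂ e≡b)
    ... | no e∉₀ | no e≢b = contradiction (close c∈K y∈ c≢y a∈Ec a∉ b∈Ec b∉y) a≢b
      where
      e∉a : e ∉ E a
      e∉a e∈a = e∉₀ (fromA e∈a e≢b)
      y≢x₀ : y ≢ x₀
      y≢x₀ refl = e∉₀ e∈
      y≢a : y ≢ a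
      y≢a refl = e∉a e∈
      a∉ : a ∉ E y
      a∉ a∈y with close y∈ a∈K y≢a a∈y (irr a∈K) e∈ e∉a
      ... | refl = e∉₀ a∈
      b∉y : b ∉ E y
      b∉y b∈y = e≢b (close y∈ x₀∈ y≢x₀ e∈ e∉₀ b∈y b∉)
      c≢y : c ≢ y
      c≢y refl = irr y∈ (transfer x₀∈ y∈ (y≢x₀ ∘ sym) a∈ a∉ c∈ c≢a)

    in-K : ∀ {x} → x ∈ E x₀ ∪ ⁅ b ⁆ → x ∈ K
    in-K x∈ with B∋ x∈
    ... | inj₁ x∈₀ = E⊆K x₀∈ x∈₀
    ... | inj₂ refl = b∈K

    -- `E x` omits `x`, so it keeps every other element of whichever of `E x₀`, `E a` and `E c`
    -- contains both `x` and `p`.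
    full : ∀ {x} → x ∈ E x₀ ∪ ⁅ b ⁆ → ∀ {p} → p ∈ E x₀ ∪ ⁅ b ⁆ → p ≢ x → p ∈ E x
    full {x} x∈ {p} p∈ p≢x with B∋ x∈ | B∋ p∈
    ... | inj₁ x∈₀ | inj₁ p∈₀ =
      transfer x₀∈ (E⊆K x₀∈ x∈₀) (x₀≢ x∈₀) x∈₀ (irr (E⊆K x₀∈ x∈₀)) p∈₀ p≢x
    ... | inj₁ x∈₀ | inj₂ refl with x ≟ a
    ...   | yes refl = b∈
    ...   | no x≢a = transfer a∈K (E⊆K x₀∈ x∈₀) (x≢a ∘ sym) (toA x∈₀ x≢a) (irr (E⊆K x₀∈ x∈₀)) b∈ p≢x
    full {x} x∈ {p} p∈ p≢x | inj₂ refl | inj₂ refl = contradiction refl p≢x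
    full {x} x∈ {p} p∈ p≢x | inj₂ refl | inj₁ p∈₀ with p ≟ a
    ...   | yes refl = transfer c∈K b∈K c≢b b∈Ec (irr b∈K) a∈Ec p≢x
    ...   | no p≢a = transfer a∈K b∈K a≢b b∈ (irr b∈K) (toA p∈₀ p≢a) p≢x

-- All fibres are nonempty and their sizes sum to `d`, so each has one element.
onto-injective : {σ : Subset n} {t : Fin n → Fin d} → ∣ σ ∣ ≡ d →
  (∀ r → ∃ λ z → z ∈ σ × t z ≡ r) → ∀ {x y} → x ∈ σ → y ∈ σ → t x ≡ t y → x ≡ y
onto-injective {σ = σ} {t} ∣σ∣ onto {x} {y} x∈ y∈ e with x ≟ y
... | yes x≡y = x≡y
... | no x≢y = contradiction
  (Σ≡d⇒all-one (cnt σ t) (λ r → let _ , z∈ , tz = onto r in ∈⇒1≤∣∣ (∈-fibre⁺ z∈ tz))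
    (trans (sym (∣K∣≡Σcnt σ t)) ∣σ∣) (t y))
  (λ e₁ → <⇒≢ (2≤∣∣ (∈-fibre⁺ y∈ refl) (∈-fibre⁺ x∈ e) x≢y) (sym e₁))

∪∩-size : (p q : Subset n) → ∣ p ∣ + ∣ q ∣ ≡ ∣ p ∪ q ∣ + ∣ p ∩ q ∣
∪∩-size [] [] = refl
∪∩-size (outside ∷ p) (outside ∷ q) = ∪∩-size p q
∪∩-size (inside ∷ p) (outside ∷ q) = cong suc (∪∩-size p q)
∪∩-size (outside ∷ p) (inside ∷ q) = trans (+-suc ∣ p ∣ ∣ q ∣) (cong suc (∪∩-size p q))
∪∩-size (inside ∷ p) (inside ∷ q) = cong suc
  (trans (+-suc ∣ p ∣ ∣ q ∣) (trans (cong suc (∪∩-size p q)) (sym (+-suc ∣ p ∪ q ∣ ∣ p ∩ q ∣))))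

common-element : (p q : Subset n) {s : Subset n} → p ⊆ s → q ⊆ s → ∣ s ∣ < ∣ p ∣ + ∣ q ∣ →
  ∃ λ z → z ∈ p × z ∈ q
common-element p q {s} p⊆ q⊆ s< = let z , z∈ = inhabited {p = p ∩ q} 1≤ in z , x∈p∩q⁻ p q z∈
  where
  ∪≤ : ∣ p ∪ q ∣ ≤ ∣ s ∣
  ∪≤ = p⊆q⇒∣p∣≤∣q∣ {p = p ∪ q} {q = s} λ z∈ → [ p⊆ , q⊆ ]′ (x∈p∪q⁻ p q z∈)
  1≤ : 1 ≤ ∣ p ∩ q ∣
  1≤ = +-cancelˡ-≤ (∣ p ∪ q ∣) _ _ (≤-trans (≤-reflexive (+-comm (∣ p ∪ q ∣) 1))
    (≤-trans (s≤s ∪≤) (≤-trans s< (≤-reflexive (∪∩-size p q)))))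

Onto : Subset n → (Fin n → Fin d) → Set
Onto K t = ∀ r → ∃ λ z → z ∈ K × t z ≡ r

choose : {A : Set} {P : Fin n → A → Set} (K : Subset n) → A → (∀ x → x ∈ K → Σ A (P x)) →
  Σ (Fin n → A) λ F → ∀ {x} → x ∈ K → P x (F x)
choose {A = A} {P} K a f = F , prf
  where
  F : _ → A
  F x with x ∈? K
  ... | yes x∈ = proj₁ (f x x∈)
  ... | no _ = a
  prf : ∀ {x} → x ∈ K → P x (F x)
  prf {x} x∈ with x ∈? K
  ... | yes x∈′ = proj₂ (f x x∈′)
  ... | no x∉ = contradiction x∈ x∉

-- Amalgamation of good topes

module Topes {n d : ℕ} (m : Subset n → Fin n → Fin d)
  (m-onto : ∀ {σ} → ∣ σ ∣ ≡ d → Onto σ (m σ)) where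

  -- A tope on K is given by a total function whose values off K are junk, so that
  -- deleting left nodes changes K but not t.
  record Good (K : Subset n) (t : Fin n → Fin d) : Set where
    constructor good
    field
      onto : Onto K t
      transversal : ∀ {σ} → σ ⊆ K → ∣ σ ∣ ≡ d → Onto σ t → ∀ {z} → z ∈ σ → m σ z ≡ t z
  open Good public

  good-cong : ∀ {K t t′} → (∀ {z} → z ∈ K → t z ≡ t′ z) → Good K t → Good K t′
  good-cong {K} {t} {t′} e g = good
    (λ r → let z , z∈ , tz = onto g r in z , z∈ , trans (sym (e z∈)) tz)
    (λ σ⊆ ∣σ∣ on z∈ → trans
      (transversal g σ⊆ ∣σ∣ (λ r → let y , y∈ , ty = on r in y , y∈ , trans (e (σ⊆ y∈)) ty) z∈)
      (e (σ⊆ z∈)))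

  -- The only transversal inside a set of size `d` is the set itself.
  good-base : ∀ {K} → ∣ K ∣ ≡ d → Good K (m K)
  good-base {K} ∣K∣ = good (m-onto ∣K∣) λ σ⊆ ∣σ∣ _ {z} _ →
    cong (λ τ → m τ z) (⊆-antisym σ⊆ (same-size σ⊆ (trans ∣σ∣ (sym ∣K∣))))

  good-del : ∀ {K t x y} → Good K t → y ∈ K ∖ x → t y ≡ t x → Good (K ∖ x) t
  good-del {K} {t} {x} {y} g y∈ e = good on λ σ⊆ → transversal g (λ z∈ → ∖⊆ (σ⊆ z∈))
    where
    on : Onto (K ∖ x) t
    on r with onto g r
    ... | z , z∈ , tz with z ≟ x
    ...   | yes refl = y , y∈ , trans e tz
    ...   | no z≢x = z , ∈-∖ z∈ z≢x , tz

  -- A transversal contains at most one of `x` and `y`, which share a fibre, so it lies in `K ∖ x`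
  -- or in `K ∖ y`.
  good-ext : ∀ {K t x y} → x ∈ K → y ∈ K → y ≢ x → t y ≡ t x →
    Good (K ∖ x) t → Good (K ∖ y) t → Good K t
  good-ext {K} {t} {x} {y} x∈ y∈ y≢x e gx gy = good
    (λ r → let z , z∈ , tz = onto gx r in z , ∖⊆ z∈ , tz) tr
    where
    tr : ∀ {σ} → σ ⊆ K → ∣ σ ∣ ≡ d → Onto σ t → ∀ {z} → z ∈ σ → m σ z ≡ t z
    tr {σ} σ⊆ ∣σ∣ on with x ∈? σ | y ∈? σ
    ... | no x∉ | _ = transversal gx (λ z∈ → ∈-∖ (σ⊆ z∈) λ { refl → x∉ z∈ }) ∣σ∣ on
    ... | _ | no y∉ = transversal gy (λ z∈ → ∈-∖ (σ⊆ z∈) λ { refl → y∉ z∈ }) ∣σ∣ on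
    ... | yes x∈σ | yes y∈σ = contradiction (onto-injective ∣σ∣ on y∈σ x∈σ e) y≢x

  good-pos : ∀ {K t} → Good K t → ∀ r → 1 ≤ cnt K t r
  good-pos g r = let _ , z∈ , tz = onto g r in ∈⇒1≤∣∣ (∈-fibre⁺ z∈ tz)

  Tope : Subset n → (Fin n → Fin d) → (Fin d → ℕ) → Set
  Tope K t v = Good K t × HasType K t v

  tope-cong : ∀ {K t t′ v} → (∀ {z} → z ∈ K → t z ≡ t′ z) → Tope K t v → Tope K t′ v
  tope-cong {K} {t} {t′} e (g , ty) = good-cong e g , λ r → trans (sym (cnt-cong {K = K} {t} {t′} e r)) (ty r)

  tope-retype : ∀ {K t u v} → (∀ s → u s ≡ v s) → Tope K t u → Tope K t v
  tope-retype e (g , ty) = g , λ s → trans (ty s) (e s)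

  tope-del : ∀ {K t u q x} → (∀ s → 1 ≤ u s) → x ∈ K → t x ≡ q →
    Tope K t (bump u q) → Tope (K ∖ x) t u
  tope-del {K} {t} {u} {q} {x} 1≤u x∈ refl (g , ty) with type-del {t = t} {u} x∈ refl ty
  ... | ty′ with fibre-elt {K = K ∖ x} {t} {t x} (subst (1 ≤_) (sym (ty′ (t x))) (1≤u (t x)))
  ... | y , y∈ , e = good-del g y∈ e , ty′

  Unique : Subset n → Set
  Unique K = ∀ {t t′ v} → Tope K t v → Tope K t′ v → ∀ {z} → z ∈ K → t z ≡ t′ z

  Exists : Subset n → Set
  Exists K = ∀ v → (∀ s → 1 ≤ v s) → ∣ K ∣ ≡ Σ′ v → Σ (Fin n → Fin d) λ t → Tope K t v

  -- The topes of type u on the sets K ∖ x should be the orientations, towards the left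
  -- nodes x, of one tree on K; T is the orientation of this tree towards r.
  Absorbs : Subset n → (Fin d → ℕ) → Fin d → (Fin n → Fin d) → Set
  Absorbs K u r T = ∀ {x f} → x ∈ K → Tope (K ∖ x) f u → ∀ {z} → z ∈ K ∖ x → f z ≡ r → T z ≡ r

  Amalgam : Subset n → (Fin d → ℕ) → Fin d → (Fin n → Fin d) → Set
  Amalgam K u r T = Tope K T (bump u r) × Absorbs K u r T

  -- The tree is not built here; it is encoded by its orientations towards all right nodes `r`.
  Linked : Subset n → Set
  Linked K = ∀ u → (∀ s → 1 ≤ u s) → ∣ K ∣ ≡ suc (Σ′ u) → ∀ r → ∃ (Amalgam K u r)

  base-agree : ∀ {K t t′} → ∣ K ∣ ≡ d → Good K t → Good K t′ → ∀ {z} → z ∈ K → t z ≡ t′ z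
  base-agree ∣K∣ g g′ z∈ =
    trans (sym (transversal g ⊆-refl ∣K∣ (onto g) z∈)) (transversal g′ ⊆-refl ∣K∣ (onto g′) z∈)

  exists-base : ∀ {K} → ∣ K ∣ ≡ d → Exists K
  exists-base {K} ∣K∣ v 1≤v e = m K , good-base ∣K∣ , λ s →
    trans (Σ≡d⇒all-one (cnt K (m K)) (good-pos (good-base ∣K∣)) (trans (sym (∣K∣≡Σcnt K (m K))) ∣K∣) s)
      (sym (Σ≡d⇒all-one v 1≤v (trans (sym e) ∣K∣) s))

  split-type : ∀ {K : Subset n} v → (∀ s → 1 ≤ v s) → ∣ K ∣ ≡ Σ′ v → d < ∣ K ∣ →
    Σ (Fin d → ℕ) λ u → ∃ λ r → (∀ s → 1 ≤ u s) × (∀ s → v s ≡ bump u r s) × ∣ K ∣ ≡ suc (Σ′ u)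
  split-type v 1≤v e d< with exists-≥2 v (subst (d <_) e d<)
  ... | r , 2≤ with unbump v 2≤ 1≤v
  ... | u , v≡ , 1≤u = u , r , 1≤u , v≡ , trans e (trans (Σ′-cong v≡) (Σ′-bump u r))

  exists-step : ∀ {K} → d < ∣ K ∣ → Linked K → Exists K
  exists-step {K} d< lk v 1≤v e with split-type {K} v 1≤v e d<
  ... | u , r , 1≤u , v≡ , e′ with lk u 1≤u e′ r
  ... | T , tope , _ = T , tope-retype (λ s → sym (v≡ s)) tope

  -- Take two elements `x`, `y` that `f` sends to `r`. Without `y`, `f` has type `u`, so absorption
  -- makes `A` send `x` to `r` as well; without `x`, both are topes of type `u` on `K ∖ x` and
  -- coincide.
  amalgam-unique : ∀ {K u r A f} → (∀ s → 1 ≤ u s) → (∀ {x} → x ∈ K → Unique (K ∖ x)) →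
    Amalgam K u r A → Tope K f (bump u r) → ∀ {z} → z ∈ K → f z ≡ A z
  amalgam-unique {K} {u} {r} {A} {f} 1≤u uq (A-tope , ab) F {z} z∈ = finish
    (fibre-two {K = K} {f} {r} (subst (2 ≤_) (sym (trans (proj₂ F r) (bump-same u r))) (s≤s (1≤u r))))
    where
    finish : (∃ λ x → ∃ λ y → (x ∈ K × f x ≡ r) × (y ∈ K × f y ≡ r) × y ≢ x) → f z ≡ A z
    finish (x , y , (x∈ , fx) , (y∈ , fy) , y≢x) with z ≟ x
      | ab y∈ (tope-del 1≤u y∈ fy F) (∈-∖ x∈ (y≢x ∘ sym)) fx
    ... | yes refl | Ax = trans fx (sym Ax)
    ... | no z≢x | Ax = uq x∈ (tope-del 1≤u x∈ fx F) (tope-del 1≤u x∈ Ax A-tope) (∈-∖ z∈ z≢x)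

  unique-step : ∀ {K} → d < ∣ K ∣ → Linked K → (∀ {x} → x ∈ K → Unique (K ∖ x)) → Unique K
  unique-step {K} d< lk uq {t} {t′} {v} T T′ z∈ with split-type {K} v
    (λ s → subst (1 ≤_) (proj₂ T s) (good-pos (proj₁ T) s)) (∣K∣≡Σ {K = K} {t} (proj₂ T)) d<
  ... | u , r , 1≤u , v≡ , e with lk u 1≤u e r
  ... | A , am = trans (amalgam-unique 1≤u uq am (tope-retype v≡ T) z∈)
    (sym (amalgam-unique 1≤u uq am (tope-retype v≡ T′) z∈))

  amalgam-retype : ∀ {K u v r T} → (∀ s → u s ≡ v s) → Amalgam K u r T → Amalgam K v r T
  amalgam-retype {r = r} e (T , ab) =
    tope-retype (bump-cong e r) T , λ x∈ F → ab x∈ (tope-retype (λ s → sym (e s)) F)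

  -- Topes of type `u` live on `K` without two elements, those of type `u` + e_r on `K` without one.
  -- `Same` and `Other` amalgamate the latter towards `r` and towards a different right node.
  module Step {K : Subset n} {u : Fin d → ℕ} (1≤u : ∀ s → 1 ≤ u s) (∣K∣ : ∣ K ∣ ≡ suc (suc (Σ′ u)))
    (linked : ∀ {x} → x ∈ K → Linked (K ∖ x))
    (unique : ∀ {x} → x ∈ K → Unique (K ∖ x))
    (unique₂ : ∀ {x y} → x ∈ K → y ∈ K ∖ x → Unique (K ∖ x ∖ y))
    (exists₂ : ∀ {x y} → x ∈ K → y ∈ K ∖ x → Exists (K ∖ x ∖ y)) where

    1≤bump : ∀ r s → 1 ≤ bump u r s
    1≤bump r s = ≤-trans (1≤u s) (u≤bump u r s)

    2≤bump : ∀ r → 2 ≤ bump u r r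
    2≤bump r = subst (2 ≤_) (sym (bump-same u r)) (s≤s (1≤u r))

    at : ∀ {x} → x ∈ K → ∀ r → ∃ (Amalgam (K ∖ x) u r)
    at x∈ r = linked x∈ u 1≤u (∣∖∣-pred x∈ ∣K∣) r

    swap : ∀ {x y t v} → Tope (K ∖ x ∖ y) t v → Tope (K ∖ y ∖ x) t v
    swap {x} {y} {t} {v} = subst (λ S → Tope S t v) (∖-comm K x y)

    module Same (r : Fin d) where
      family = choose K (λ _ → r) λ x x∈ → at x∈ r
      T : Fin n → Fin n → Fin d
      T = proj₁ family
      amalgam : ∀ {x} → x ∈ K → Amalgam (K ∖ x) u r (T x)
      amalgam = proj₂ family
      E : Fin n → Subset n
      E x = fibre (K ∖ x) (T x) r

      -- Both fibres contain the fibre over `r` of the tope of type `u` on `K ∖ x ∖ y`, which is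
      -- smaller by one.
      close : ∀ {x y} → x ∈ K → y ∈ K → x ≢ y →
        ∀ {a b} → a ∈ E x → a ∉ E y → b ∈ E x → b ∉ E y → a ≡ b
      close {x} {y} x∈ y∈ x≢y = at-most-one-outside {p = E x} {E y} {F} F⊆x F⊆y
        (trans (proj₂ (proj₁ (amalgam x∈)) r) (trans (bump-same u r) (cong suc (sym (proj₂ f-tope r)))))
        where
        y∈′ : y ∈ K ∖ x
        y∈′ = ∈-∖ y∈ (x≢y ∘ sym)
        x∈′ : x ∈ K ∖ y
        x∈′ = ∈-∖ x∈ x≢y
        ex = exists₂ x∈ y∈′ u 1≤u (∣∖∣-pred y∈′ (∣∖∣-pred x∈ ∣K∣))
        f = proj₁ ex
        f-tope = proj₂ ex
        F = fibre (K ∖ x ∖ y) f r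
        F⊆x : F ⊆ E x
        F⊆x z∈ = let z∈K , fz = ∈-fibre⁻ z∈ in
          ∈-fibre⁺ (∖⊆ z∈K) (proj₂ (amalgam x∈) y∈′ f-tope z∈K fz)
        F⊆y : F ⊆ E y
        F⊆y {z} z∈ = let z∈K , fz = ∈-fibre⁻ z∈
                         z∈K′ = subst (z ∈_) (∖-comm K x y) z∈K in
          ∈-fibre⁺ (∖⊆ z∈K′) (proj₂ (amalgam y∈) x∈′ (swap f-tope) z∈K′ fz)

      Union : Set
      Union = Σ (Subset n) λ B → (∀ {y} → y ∈ K → E y ⊆ B) ×
        (∀ {x} → x ∈ B → x ∈ K × (∀ {p} → p ∈ B → p ≢ x → p ∈ E x))

      -- `B` becomes the fibre over `r`; outside `B` the values come from `T p` for one `p` in `B`.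
      build : ∀ {x₀} → x₀ ∈ K → Union → ∃ (Amalgam K (bump u r) r)
      build {x₀} x₀∈ (B , below , full) = P , (good-P , type-P) , absorbs
        where
        two = fibre-two {K = K ∖ x₀} {T x₀} {r}
          (subst (2 ≤_) (sym (proj₂ (proj₁ (amalgam x₀∈)) r)) (2≤bump r))
        p = proj₁ two
        q = proj₁ (proj₂ two)
        p∈₀ = proj₁ (proj₁ (proj₂ (proj₂ two)))
        Tp = proj₂ (proj₁ (proj₂ (proj₂ two)))
        q∈₀ = proj₁ (proj₁ (proj₂ (proj₂ (proj₂ two))))
        Tq = proj₂ (proj₁ (proj₂ (proj₂ (proj₂ two))))
        q≢p = proj₂ (proj₂ (proj₂ (proj₂ two)))
        p∈ : p ∈ B
        p∈ = below x₀∈ (∈-fibre⁺ p∈₀ Tp)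
        q∈ : q ∈ B
        q∈ = below x₀∈ (∈-fibre⁺ q∈₀ Tq)
        p∈K = proj₁ (full p∈)
        P : Fin n → Fin d
        P z with z ∈? B
        ... | yes _ = r
        ... | no _ = T p z
        P-B : ∀ {z} → z ∈ B → P z ≡ r
        P-B {z} z∈ with z ∈? B
        ... | yes _ = refl
        ... | no z∉ = contradiction z∈ z∉
        -- For distinct `x` and `p` in `B`, `T x` sends `p` to `r` and `T p` sends `x` to `r`;
        -- without these elements both have type `u` on `K ∖ x ∖ p`, so they agree by uniqueness.
        P≡T : ∀ {x} → x ∈ B → ∀ {z} → z ∈ K ∖ x → T x z ≡ P z
        P≡T {x} x∈ {z} z∈ with z ∈? B
        ... | yes z∈B = proj₂ (∈-fibre⁻ (proj₂ (full x∈) z∈B (∈∖⇒≢ z∈)))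
        ... | no z∉B with x ≟ p
        ...   | yes refl = refl
        ...   | no x≢p = unique₂ x∈K p∈K∖x
                  (tope-del 1≤u p∈K∖x Txp (proj₁ (amalgam x∈K)))
                  (swap (tope-del 1≤u x∈K∖p Tpx (proj₁ (amalgam p∈K))))
                  (∈-∖ z∈ λ { refl → z∉B p∈ })
          where
          x∈K = proj₁ (full x∈)
          p∈E = ∈-fibre⁻ (proj₂ (full x∈) p∈ (x≢p ∘ sym))
          p∈K∖x = proj₁ p∈E
          Txp = proj₂ p∈E
          x∈E = ∈-fibre⁻ (proj₂ (full p∈) x∈ x≢p)
          x∈K∖p = proj₁ x∈E
          Tpx = proj₂ x∈E
        tope-at : ∀ {x} → x ∈ B → Tope (K ∖ x) P (bump u r)
        tope-at x∈ = tope-cong (P≡T x∈) (proj₁ (amalgam (proj₁ (full x∈))))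
        good-P : Good K P
        good-P = good-ext p∈K (proj₁ (full q∈)) q≢p (trans (P-B q∈) (sym (P-B p∈)))
          (proj₁ (tope-at p∈)) (proj₁ (tope-at q∈))
        type-P : HasType K P (bump (bump u r) r)
        type-P = type-add {t = P} p∈K (P-B p∈) (proj₂ (tope-at p∈))
        absorbs : Absorbs K (bump u r) r P
        absorbs x∈ F z∈ fz = P-B (below x∈ (∈-fibre⁺ z∈ (trans (unique x∈ (proj₁ (amalgam x∈)) F z∈) fz)))

      result : ∃ (Amalgam K (bump u r) r)
      result = let x₀ , x₀∈ = inhabited {p = K} (subst (1 ≤_) (sym ∣K∣) (s≤s z≤n)) in
        build x₀∈ (Triangle.union K E (2≤bump r) (λ _ z∈ → ∖⊆ (proj₁ (∈-fibre⁻ z∈)))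
          (λ _ x∈ → ∉∖ K _ (proj₁ (∈-fibre⁻ x∈))) (λ x∈ → proj₂ (proj₁ (amalgam x∈)) r) close x₀∈)

    -- Every z in the fibre of T over j also lies in that of a, which forces N z w = r; so N z
    -- agrees with T off w, and T with w added to the fibre over r is the amalgam.
    module Other {r j : Fin d} (r≢j : r ≢ j) {a ρ : Fin n → Fin d}
      (A : Amalgam K (bump u j) j a) (R : Amalgam K (bump u r) r ρ) where

      pivot = onto (proj₁ (proj₁ A)) r
      w = proj₁ pivot
      w∈ = proj₁ (proj₂ pivot)
      aw = proj₂ (proj₂ pivot)

      T = proj₁ (at w∈ j)
      T-tope = proj₁ (proj₂ (at w∈ j))

      P : Fin n → Fin d
      P z with z ≟ w
      ... | yes _ = r
      ... | no _ = T z

      T≡P : ∀ {z} → z ∈ K ∖ w → T z ≡ P z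
      T≡P {z} z∈ with z ≟ w
      ... | yes z≡w = contradiction z≡w (∈∖⇒≢ z∈)
      ... | no _ = refl

      module _ {z : Fin n} (z∈ : z ∈ K ∖ w) (Tz : T z ≡ j) where
        z∈K = ∖⊆ z∈
        az : a z ≡ j
        az = proj₂ A w∈ T-tope z∈ Tz
        N = proj₁ (at z∈K r)
        N-tope = proj₁ (proj₂ (at z∈K r))
        w∈K∖z : w ∈ K ∖ z
        w∈K∖z = ∈-∖ w∈ λ w≡z → r≢j (trans (sym aw) (trans (cong a w≡z) az))
        a-tope : Tope (K ∖ z) a (bump u j)
        a-tope = tope-del (1≤bump j) z∈K az (proj₁ A)
        -- Removing from `a` one more element `x` over `j` leaves a tope of type `u` on `K ∖ z ∖ x`
        -- with `w` over `r`, and `N` absorbs it.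
        Nw : N w ≡ r
        Nw with fibre-elt {K = K ∖ z} {a} {j} (good-pos (proj₁ a-tope) j)
        ... | x , x∈ , ax = proj₂ (proj₂ (at z∈K r)) x∈ (tope-del 1≤u x∈ ax a-tope)
          (∈-∖ w∈K∖z λ w≡x → r≢j (trans (sym aw) (trans (cong a w≡x) ax))) aw
        N≡P : ∀ {y} → y ∈ K ∖ z → N y ≡ P y
        N≡P {y} y∈ with y ≟ w
        ... | yes refl = Nw
        ... | no y≢w = unique₂ z∈K w∈K∖z (tope-del 1≤u w∈K∖z Nw N-tope)
          (swap (tope-del 1≤u z∈ Tz T-tope)) (∈-∖ y∈ y≢w)
        P-tope : Tope (K ∖ z) P (bump u r)
        P-tope = tope-cong N≡P N-tope

      result : ∃ (Amalgam K (bump u r) j)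
      result with fibre-two {K = K ∖ w} {T} {j} (subst (2 ≤_) (sym (proj₂ T-tope j)) (2≤bump j))
      ... | p , q , (p∈ , Tp) , (q∈ , Tq) , q≢p = P , (good-P , type-P) , absorbs
        where
        Pp : P p ≡ j
        Pp = trans (sym (T≡P p∈)) Tp
        good-P : Good K P
        good-P = good-ext (∖⊆ p∈) (∖⊆ q∈) q≢p (trans (trans (sym (T≡P q∈)) Tq) (sym Pp))
          (proj₁ (P-tope p∈ Tp)) (proj₁ (P-tope q∈ Tq))
        type-P : HasType K P (bump (bump u r) j)
        type-P = type-add {t = P} (∖⊆ p∈) Pp (proj₂ (P-tope p∈ Tp))
        tope : Tope K P (bump (bump u j) r)
        tope = tope-retype (bump-comm u r j) (good-P , type-P)
        -- The fibres of `P` and `f` over `r` have `u r` + 1 elements each and lie in that of `ρ`,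
        -- which has `u r` + 2; as `u r` is positive, they share some `w′`. Without `w′`, `P` is the
        -- amalgam of type `u` + e_j towards `j`, and this absorbs `f`.
        absorbs : Absorbs K (bump u r) j P
        absorbs {y} {f} y∈ F {z} z∈ fz =
          finish (common-element (fibre K P r) (fibre (K ∖ y) f r) {fibre K ρ r} P⊆ f⊆ size)
          where
          P⊆ : fibre K P r ⊆ fibre K ρ r
          P⊆ {x} x∈ with ∈-fibre⁻ x∈
          ... | x∈K , Px = ∈-fibre⁺ x∈K (proj₂ R (∖⊆ p∈) (P-tope p∈ Tp)
                  (∈-∖ x∈K λ x≡p → r≢j (trans (sym Px) (trans (cong P x≡p) Pp))) Px)
          f⊆ : fibre (K ∖ y) f r ⊆ fibre K ρ r
          f⊆ x∈ with ∈-fibre⁻ x∈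
          ... | x∈K , fx = ∈-fibre⁺ (∖⊆ x∈K) (proj₂ R y∈ F x∈K fx)
          ∣P∣ : cnt K P r ≡ suc (u r)
          ∣P∣ = trans (type-P r) (trans (bump-other (bump u r) (r≢j ∘ sym)) (bump-same u r))
          ∣f∣ : cnt (K ∖ y) f r ≡ suc (u r)
          ∣f∣ = trans (proj₂ F r) (bump-same u r)
          size : cnt K ρ r < cnt K P r + cnt (K ∖ y) f r
          size = subst₂ _<_
            (sym (trans (proj₂ (proj₁ R) r) (trans (bump-same (bump u r) r) (cong suc (bump-same u r)))))
            (sym (cong₂ _+_ ∣P∣ ∣f∣))
            (s≤s (subst (suc (suc (u r)) ≤_) (sym (+-suc (u r) (u r)))
              (s≤s (+-monoˡ-≤ (u r) (1≤u r)))))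
          finish : (∃ λ w′ → w′ ∈ fibre K P r × w′ ∈ fibre (K ∖ y) f r) → P z ≡ j
          finish (w′ , w′∈P , w′∈f) = trans (unique w′∈K P′ (proj₁ (proj₂ T′)) z∈K∖w′)
            (proj₂ (proj₂ T′) y∈K∖w′ F′ (subst (z ∈_) (∖-comm K y w′) z∈′) fz)
            where
            w′∈K = proj₁ (∈-fibre⁻ w′∈P)
            w′∈K∖y = proj₁ (∈-fibre⁻ w′∈f)
            fw′ = proj₂ (∈-fibre⁻ w′∈f)
            T′ = at w′∈K j
            P′ : Tope (K ∖ w′) P (bump u j)
            P′ = tope-del (1≤bump j) w′∈K (proj₂ (∈-fibre⁻ w′∈P)) tope
            F′ : Tope (K ∖ w′ ∖ y) f u
            F′ = swap (tope-del 1≤u w′∈K∖y fw′ F)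
            y∈K∖w′ : y ∈ K ∖ w′
            y∈K∖w′ = ∈-∖ y∈ (∈∖⇒≢ w′∈K∖y ∘ sym)
            z∈′ : z ∈ K ∖ y ∖ w′
            z∈′ = ∈-∖ z∈ λ z≡w′ → r≢j (trans (sym fw′) (trans (cong f (sym z≡w′)) fz))
            z∈K∖w′ : z ∈ K ∖ w′
            z∈K∖w′ = ∈-∖ (∖⊆ z∈) (∈∖⇒≢ z∈′)

  -- Induction on the size of the ground set

  good-del-large : ∀ {K t x} → Good K t → x ∈ K → 2 ≤ cnt K t (t x) → Good (K ∖ x) t
  good-del-large {K} {t} {x} g x∈ 2≤
    with fibre-elt {K = K ∖ x} {t} {t x} (≤-pred (subst (2 ≤_)
           (trans (cnt-del t x∈ (t x)) (bump-same (cnt (K ∖ x) t) (t x))) 2≤))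
  ... | y , y∈ , e = good-del g y∈ e

  good-size : ∀ {K t} → Good K t → d ≤ ∣ K ∣
  good-size {K} {t} g = subst₂ _≤_ (Σ′-one {d}) (sym (∣K∣≡Σcnt K t)) (Σ′-mono (good-pos g))

  Level : ℕ → Set
  Level k = ∀ {K} → ∣ K ∣ ≡ k + d → Unique K × Exists K

  -- One element above `Level k`, since `Linked K` speaks of the topes on the sets `K ∖ x`.
  LinkedLevel : ℕ → Set
  LinkedLevel k = ∀ {K} → ∣ K ∣ ≡ suc (k + d) → Linked K

  level-base : Level 0
  level-base ∣K∣ = (λ (g , _) (g′ , _) → base-agree ∣K∣ g g′) , exists-base ∣K∣

  d<suc : ∀ k → d < suc (k + d)
  d<suc k = s≤s (m≤n+m d k)

  level-step : ∀ {k} → Level k → LinkedLevel k → Level (suc k)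
  level-step {k} lv lk ∣K∣ =
    unique-step (subst (d <_) (sym ∣K∣) (d<suc k)) (lk ∣K∣) (λ x∈ → proj₁ (lv (∣∖∣-pred x∈ ∣K∣))) ,
    exists-step (subst (d <_) (sym ∣K∣) (d<suc k)) (lk ∣K∣)

  -- If `v j` is at least 2 then `v` is some `u` + e_j and `Same` applies. Otherwise another entry
  -- `v r` is at least 2, as the sum of `v` exceeds `d`; then `v` is some `u` + e_r, and `Other`
  -- uses the amalgams that `Same` gives for `u` + e_j towards `j` and for `u` + e_r towards `r`.
  linked-step : ∀ {k} → Level k → Level (suc k) → LinkedLevel k → LinkedLevel (suc k)
  linked-step {k} lv₀ lv₁ lk {K} ∣K∣ v 1≤v e j = go (2 ≤? v j)
    where
    module S {u : Fin d → ℕ} {r : Fin d} (1≤u : ∀ s → 1 ≤ u s) (v≡ : ∀ s → v s ≡ bump u r s) =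
      Step {K = K} 1≤u (trans e (cong suc (trans (Σ′-cong v≡) (Σ′-bump u r))))
        (λ x∈ → lk (∣∖∣-pred x∈ ∣K∣)) (λ x∈ → proj₁ (lv₁ (∣∖∣-pred x∈ ∣K∣)))
        (λ x∈ y∈ → proj₁ (lv₀ (∣∖∣-pred y∈ (∣∖∣-pred x∈ ∣K∣))))
        (λ x∈ y∈ → proj₂ (lv₀ (∣∖∣-pred y∈ (∣∖∣-pred x∈ ∣K∣))))
    go : Dec (2 ≤ v j) → ∃ (Amalgam K v j)
    go (yes 2≤) with unbump v 2≤ 1≤v
    ... | u , v≡ , 1≤u = let T , am = S.Same.result {u} {j} 1≤u v≡ j in
      T , amalgam-retype {r = j} (λ s → sym (v≡ s)) am
    go (no ≱2) with exists-≥2 v (subst (d <_) (suc-injective (trans (sym ∣K∣) e)) (d<suc k))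
    ... | r , 2≤ with unbump v 2≤ 1≤v
    ... | u , v≡ , 1≤u =
      let same = S.Same.result {u} {r} 1≤u v≡
          T , am = S.Other.result {u} {r} 1≤u v≡ r≢j (proj₂ (same j)) (proj₂ (same r)) in
      T , amalgam-retype {r = j} (λ s → sym (v≡ s)) am
      where
      r≢j : r ≢ j
      r≢j refl = ≱2 2≤

  module Stack (linked-base : LinkedLevel 0) where

    abstract
      levels : ∀ k → Level k × Level (suc k) × LinkedLevel k
      levels zero = level-base , level-step level-base linked-base , linked-base
      levels (suc k) with levels k
      ... | lv₀ , lv₁ , lk₀ with linked-step lv₀ lv₁ lk₀
      ... | lk₁ = lv₁ , level-step lv₁ lk₁ , lk₁

      unique : ∀ {K} → d ≤ ∣ K ∣ → Unique K
      unique {K} d≤ = proj₁ (proj₁ (levels (∣ K ∣ ∸ d)) (sym (m∸n+n≡m d≤)))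

      exists : ∀ {K} → d ≤ ∣ K ∣ → Exists K
      exists {K} d≤ = proj₂ (proj₁ (levels (∣ K ∣ ∸ d)) (sym (m∸n+n≡m d≤)))

      linked : ∀ {K} → d < ∣ K ∣ → Linked K
      linked {K} d< = proj₂ (proj₂ (levels (∣ K ∣ ∸ suc d)))
        (sym (trans (sym (+-suc (∣ K ∣ ∸ suc d) d)) (m∸n+n≡m d<)))

    d≤-del : ∀ {K : Subset n} {x} → x ∈ K → d < ∣ K ∣ → d ≤ ∣ K ∖ x ∣
    d≤-del {K} x∈ d< = ≤-pred (subst (d <_) (∣∖∣ K x∈) d<)

    -- One step of the walk from the right node q towards x in the tree of type u on K.
    record Move (K : Subset n) (u : Fin d → ℕ) (q : Fin d) (x : Fin n) (t g : Fin n → Fin d) : Set where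
      field
        {elt} : Fin n
        {next} : Fin n → Fin d
        elt∈ : elt ∈ K
        elt-fibre : t elt ≡ q
        next-agrees : ∀ {z} → z ∈ K ∖ elt → t z ≡ next z
        next-tope : Tope K next (bump u (g elt))
        decreases : ∣ mismatch (K ∖ x) next g ∣ < ∣ mismatch (K ∖ x) t g ∣

    -- As `t` has one element more over `q` than `g`, some `y` other than `x` has `t y ≡ q` but
    -- `g y ≢ q`. The amalgam towards `g y` sends `y` to `g y` and, by uniqueness on `K ∖ y`, agrees
    -- with `t` elsewhere, so one mismatch disappears.
    move : ∀ {K u q x t g} → (∀ s → 1 ≤ u s) → d < ∣ K ∣ → Tope K t (bump u q) →
      x ∈ K → Tope (K ∖ x) g u → t x ≢ q → Move K u q x t g
    move {K} {u} {q} {x} {t} {g} 1≤u d< T x∈ G tx≢q =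
      finish (outsider (fibre K t q) (fibre (K ∖ x) g q)
        (≤-reflexive (sym (trans (proj₂ T q) (trans (bump-same u q) (cong suc (sym (proj₂ G q))))))))
      where
      finish : (∃ λ y → y ∈ fibre K t q × y ∉ fibre (K ∖ x) g q) → Move K u q x t g
      finish (y , y∈fib , y∉fib) = record
        { elt∈ = y∈ ; elt-fibre = ty
        ; next-agrees = agrees ; next-tope = proj₁ (proj₂ am)
        ; decreases = p⊂q⇒∣p∣<∣q∣ ((λ {z} → sub {z}) , y , ∈-mismatch⁺ y∈K∖x (λ e → gy≢q (trans (sym e) ty)) ,
            λ y∈m → proj₂ (∈-mismatch⁻ y∈m) Ny) }
        where
        y∈ = proj₁ (∈-fibre⁻ y∈fib)
        ty = proj₂ (∈-fibre⁻ y∈fib)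
        y≢x : y ≢ x
        y≢x refl = tx≢q ty
        y∈K∖x : y ∈ K ∖ x
        y∈K∖x = ∈-∖ y∈ y≢x
        gy≢q : g y ≢ q
        gy≢q e = y∉fib (∈-fibre⁺ y∈K∖x e)
        am = linked d< u 1≤u (trans (∣K∣≡Σ {K = K} {t} (proj₂ T)) (Σ′-bump u q)) (g y)
        N = proj₁ am
        Ny : N y ≡ g y
        Ny = proj₂ (proj₂ am) x∈ G y∈K∖x refl
        agrees : ∀ {z} → z ∈ K ∖ y → t z ≡ N z
        agrees = unique (d≤-del y∈ d<) (tope-del 1≤u y∈ ty T) (tope-del 1≤u y∈ Ny (proj₁ (proj₂ am)))
        sub : mismatch (K ∖ x) N g ⊆ mismatch (K ∖ x) t g
        sub {z} z∈m with ∈-mismatch⁻ z∈m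
        ... | z∈ , Nz≢ = ∈-mismatch⁺ z∈ λ tz → Nz≢ (trans (sym (agrees (∈-∖ (∖⊆ z∈) λ { refl → Nz≢ Ny }))) tz)

-- Compatibility of good topes with the matching field

module Compatibility {n d : ℕ} (m : Subset n → Fin n → Fin d)
  (m-onto : ∀ {σ} → ∣ σ ∣ ≡ d → Onto σ (m σ))
  (linked-base : Topes.LinkedLevel m m-onto 0) where

  open Topes m m-onto
  open Stack linked-base

  Differ : Subset n → (Fin n → Fin d) → (Fin n → Fin d) → Subset d → Set
  Differ K t t′ I = ∀ {c} → c ∈ I → ∃ λ y → y ∈ K × t y ≡ c × t′ y ≢ c

  -- Impossible for nonempty I: move t through its tree towards an element x of a
  -- t′-fibre of size ≥ 2 and delete x. If some c in I would lose its last differing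
  -- element on the way, then another element z has t z = t′ z = c, and either z can be
  -- deleted from K or c from I.
  record Conflict (K : Subset n) (t t′ : Fin n → Fin d) (I : Subset d) : Set where
    constructor conflict
    field
      good-t : Good K t
      good-t′ : Good K t′
      thin : ∀ c → c ∉ I → cnt K t′ c ≤ 1
      differ : Differ K t t′ I
  open Conflict

  conflict-del : ∀ {K t t′ I x} → Conflict K t t′ I → x ∈ K → Good (K ∖ x) t → Good (K ∖ x) t′ →
    Differ (K ∖ x) t t′ I → Conflict (K ∖ x) t t′ I
  conflict-del {K} {t′ = t′} {x = x} C x∈ g g′ df = conflict g g′
    (λ c c∉ → ≤-trans (≤-trans (u≤bump (cnt (K ∖ x) t′) (t′ x) c) (≤-reflexive (sym (cnt-del t′ x∈ c))))
      (thin C c c∉)) df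

  data Reduced (K : Subset n) (t t′ : Fin n → Fin d) (I : Subset d) : Set where
    drop-left : ∀ {x} → x ∈ K → Conflict (K ∖ x) t t′ I → Reduced K t t′ I
    drop-right : ∀ {c} → c ∈ I → Conflict K t t′ (I ∖ c) → Reduced K t t′ I

  -- Since `z` is not a differing element, it can be deleted if its `t′`-fibre has two elements;
  -- otherwise that fibre is thin and `c` can leave `I`.
  reduce-at-loop : ∀ {K t t′ I z c} → Conflict K t t′ I → z ∈ K → t z ≡ c → t′ z ≡ c → c ∈ I →
    2 ≤ cnt K t c → Reduced K t t′ I
  reduce-at-loop {K} {t} {t′} {I} {z} {c} C z∈ tz t′z c∈ 2≤ with 2 ≤? cnt K t′ c
  ... | yes 2≤′ = drop-left z∈ (conflict-del C z∈
          (good-del-large (good-t C) z∈ (subst (λ r → 2 ≤ cnt K t r) (sym tz) 2≤))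
          (good-del-large (good-t′ C) z∈ (subst (λ r → 2 ≤ cnt K t′ r) (sym t′z) 2≤′))
          df)
    where
    df : Differ (K ∖ z) t t′ I
    df e∈ with differ C e∈
    ... | y , y∈ , ty , t′y = y , ∈-∖ y∈ (λ { refl → t′y (trans t′z (trans (sym tz) ty)) }) , ty , t′y
  ... | no ≱2 = drop-right c∈ (conflict (good-t C) (good-t′ C) th (λ e∈ → differ C (∖⊆ e∈)))
    where
    ≤1 : cnt K t′ c ≤ 1
    ≤1 = ≤-pred (≰⇒> ≱2)
    th : ∀ e → e ∉ I ∖ c → cnt K t′ e ≤ 1
    th e e∉ with e ≟ c
    ... | yes refl = ≤1
    ... | no e≢c = thin C e λ e∈ → e∉ (∈-∖ e∈ e≢c)

  -- Losing `x` harms only the right node `t x`. If this lies in `I` and no other differing element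
  -- lies over it, then any other element of its `t`-fibre has equal values under `t` and `t′`.
  differ-or-reduce : ∀ {K t t′ I x u} → Conflict K t t′ I → (∀ s → 1 ≤ u s) → x ∈ K →
    Tope K t (bump u (t x)) → Differ (K ∖ x) t t′ I ⊎ Reduced K t t′ I
  differ-or-reduce {K} {t} {t′} {I} {x} {u} C 1≤u x∈ T
    with any? (λ y → (y ∈? K ∖ x) ×-dec ((t y ≟ t x) ×-dec ¬? (t′ y ≟ t x))) | t x ∈? I
  ... | yes (y , y∈ , ty , t′y) | _ = inj₁ df
    where
    df : Differ (K ∖ x) t t′ I
    df {c} c∈ with differ C c∈ | c ≟ t x
    ... | _ | yes refl = y , y∈ , ty , t′y
    ... | z , z∈ , tz , t′z | no c≢ = z , ∈-∖ z∈ (λ { refl → c≢ (sym tz) }) , tz , t′z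
  ... | no _ | no tx∉ = inj₁ df
    where
    df : Differ (K ∖ x) t t′ I
    df {c} c∈ with differ C c∈
    ... | z , z∈ , tz , t′z = z , ∈-∖ z∈ (λ { refl → tx∉ (subst (_∈ I) (sym tz) c∈) }) , tz , t′z
  ... | no none | yes tx∈ = inj₂ (finish
      (fibre-elt {K = K ∖ x} {t} {t x} (good-pos (proj₁ (tope-del 1≤u x∈ refl T)) (t x))))
    where
    finish : (∃ λ z → z ∈ K ∖ x × t z ≡ t x) → Reduced K t t′ I
    finish (z , z∈ , tz) = reduce-at-loop C (∖⊆ z∈) tz
      (decidable-stable (t′ z ≟ t x) λ t′z → none (z , z∈ , tz , t′z)) tx∈
      (subst (2 ≤_) (sym (trans (proj₂ T (t x)) (bump-same u (t x)))) (s≤s (1≤u (t x))))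

  -- The walk in the tree of type `u` goes from `q`, towards which `t` orients it, to the left node
  -- `x`, towards which `g` does. The large fibre allows `x` to be deleted from `t′` on arrival.
  record Walk (K : Subset n) (t t′ : Fin n → Fin d) : Set where
    field
      {u} : Fin d → ℕ
      {q} : Fin d
      {x} : Fin n
      {g} : Fin n → Fin d
      1≤u : ∀ s → 1 ≤ u s
      T : Tope K t (bump u q)
      x∈ : x ∈ K
      G : Tope (K ∖ x) g u
      2≤ : 2 ≤ cnt K t′ (t′ x)

  distance : ∀ {K t t′} → Walk K t t′ → ℕ
  distance {K} {t} W = let open Walk W in ∣ mismatch (K ∖ x) t g ∣

  start-walk : ∀ {K t t′} → d < ∣ K ∣ → Good K t → Good K t′ → Walk K t t′
  start-walk {K} {t} {t′} d< g g′
    with exists-≥2 (cnt K t′) (subst (d <_) (∣K∣≡Σcnt K t′) d<)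
       | split-type {K} (cnt K t) (good-pos g) (∣K∣≡Σcnt K t) d<
  ... | c , 2≤ | u , q , 1≤u , v≡ , e with fibre-elt {K = K} {t′} {c} (≤-trans (s≤s z≤n) 2≤)
  ... | x , x∈ , t′x = record
    { 1≤u = 1≤u ; T = g , v≡ ; x∈ = x∈ ; G = proj₂ (exists (d≤-del x∈ d<) u 1≤u (∣∖∣-pred x∈ e))
    ; 2≤ = subst (λ r → 2 ≤ cnt K t′ r) (sym t′x) 2≤ }

  mutual
    -- Lexicographic descent on the excess `k` of `K` over `d`, the size `i` of `I` and the bound
    -- `D` on the distance left to walk. For `k` = 0 both topes equal `m K`, so nothing differs.
    no-conflict : ∀ k i {K t t′ I} → ∣ K ∣ ≡ k + d → ∣ I ∣ ≡ i → (∃ λ c → c ∈ I) → ¬ Conflict K t t′ I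
    no-conflict zero i ∣K∣ ∣I∣ (c , c∈) C = let y , y∈ , ty , t′y = differ C c∈ in
      t′y (trans (sym (base-agree ∣K∣ (good-t C) (good-t′ C) y∈)) ty)
    no-conflict (suc k) i ∣K∣ ∣I∣ ne C = no-walk (suc k) i _ ∣K∣ ∣I∣ ne C
      (start-walk (subst (d <_) (sym ∣K∣) (d<suc k)) (good-t C) (good-t′ C)) ≤-refl

    no-walk : ∀ k i D {K t t′ I} → ∣ K ∣ ≡ k + d → ∣ I ∣ ≡ i → (∃ λ c → c ∈ I) → Conflict K t t′ I →
      (W : Walk K t t′) → distance W < D → ⊥
    no-walk k i (suc D) {K} {t} {t′} {I} ∣K∣ ∣I∣ ne C W (s≤s ≤D) = go (t x ≟ q)
      where
      open Walk W
      d< : d < ∣ K ∣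
      d< = subst (d <_) (sym (trans (∣K∣≡Σ {K = K} {t} (proj₂ T)) (Σ′-bump u q)))
        (s≤s (≤-trans (≤-reflexive (sym (Σ′-one {d}))) (Σ′-mono 1≤u)))
      reduced : Reduced K t t′ I → ⊥
      reduced = no-reduced k i {x = x} ∣K∣ ∣I∣ ne 2≤
      at-end : t x ≡ q → Differ (K ∖ x) t t′ I ⊎ Reduced K t t′ I → ⊥
      at-end tx (inj₂ red) = reduced red
      at-end tx (inj₁ df) = reduced (drop-left x∈
        (conflict-del C x∈ (proj₁ (tope-del 1≤u x∈ tx T)) (good-del-large (good-t′ C) x∈ 2≤) df))
      onward : (mv : Move K u q x t g) → Differ (K ∖ Move.elt mv) t t′ I ⊎ Reduced K t t′ I → ⊥
      onward mv (inj₂ red) = reduced red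
      onward mv (inj₁ df) = no-walk k i D ∣K∣ ∣I∣ ne
        (conflict (proj₁ next-tope) (good-t′ C) (thin C) λ c∈ → let y , y∈ , ty , t′y = df c∈ in
          y , ∖⊆ y∈ , trans (sym (next-agrees y∈)) ty , t′y)
        (record { 1≤u = 1≤u ; T = next-tope ; x∈ = x∈ ; G = G ; 2≤ = 2≤ }) (≤-trans decreases ≤D)
        where open Move mv
      go : Dec (t x ≡ q) → ⊥
      go (yes tx) = at-end tx (differ-or-reduce C 1≤u x∈ (subst (λ r → Tope K t (bump u r)) (sym tx) T))
      go (no tx≢q) = let mv = move 1≤u d< T x∈ G tx≢q in onward mv
        (differ-or-reduce C 1≤u (Move.elt∈ mv) (subst (λ r → Tope K t (bump u r)) (sym (Move.elt-fibre mv)) T))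

    no-reduced : ∀ k i {K t t′ I x} → ∣ K ∣ ≡ k + d → ∣ I ∣ ≡ i → (∃ λ c → c ∈ I) →
      2 ≤ cnt K t′ (t′ x) → ¬ Reduced K t t′ I
    no-reduced zero i {K} ∣K∣ ∣I∣ ne 2≤ (drop-left {x} x∈ C) =
      <⇒≱ (subst (∣ K ∖ x ∣ <_) ∣K∣ (≤-reflexive (sym (∣∖∣ K x∈)))) (good-size (good-t C))
    no-reduced (suc k) i ∣K∣ ∣I∣ ne 2≤ (drop-left x∈ C) = no-conflict k i (∣∖∣-pred x∈ ∣K∣) ∣I∣ ne C
    no-reduced k zero ∣K∣ ∣I∣ ne 2≤ (drop-right c∈ C) = contradiction (subst (1 ≤_) ∣I∣ (∈⇒1≤∣∣ c∈)) λ ()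
    -- What remains of `I` contains `t′ x`: the `t′`-fibre over it has two elements, which thinness
    -- forbids outside.
    no-reduced k (suc i) {K} {t} {t′} {I} {x} ∣K∣ ∣I∣ ne 2≤ (drop-right {c} c∈ C) =
      no-conflict k i ∣K∣ (∣∖∣-pred c∈ ∣I∣)
        (t′ x , decidable-stable (t′ x ∈? I ∖ c) λ t′x∉ → <⇒≱ 2≤ (thin C (t′ x) t′x∉)) C

  Extension : (J K : Subset n) (I : Subset d) → (Fin n → Fin d) → Set
  Extension J K I f = Σ (Fin n → Fin d) λ f′ →
    Good K f′ × (∀ {y} → y ∈ J → f′ y ≡ f y) × (∀ c → c ∉ I → cnt K f′ c ≤ 1)

  -- Adding `a` raises one entry of the type of `f`; raising an entry in `I` keeps the fibres
  -- outside `I` thin. The candidates are the topes on the walk from `c` to `a`, which ends at a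
  -- tope agreeing with `f` off `a`.
  extend : ∀ {K f J I a} → d < ∣ K ∣ → a ∈ K → Good (K ∖ a) f → J ⊆ K ∖ a → (∀ {y} → y ∈ J → f y ∈ I) →
    (∃ λ c → c ∈ I) → (∀ c → c ∉ I → cnt (K ∖ a) f c ≤ 1) →
    Extension J K I f
  extend {K} {f} {J} {I} {a} d< a∈ g J⊆ J→I (c , c∈) th = start
    where
    u = cnt (K ∖ a) f
    F : Tope (K ∖ a) f u
    F = g , λ _ → refl
    Goal : Set
    Goal = Σ (Fin n → Fin d) λ t → ∃ λ s → s ∈ I × Tope K t (bump u s) × (∀ {y} → y ∈ J → t y ≡ f y)
    -- The last member of I on the walk from q to a is the one whose amalgam agrees with f on J.
    search : ∀ D {t q} → Tope K t (bump u q) → ∣ mismatch (K ∖ a) t f ∣ < D →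
      Goal ⊎ (q ∉ I × (∀ {y} → y ∈ J → t y ≡ f y))
    settle : ∀ {t q} → Tope K t (bump u q) → (∀ {y} → y ∈ J → t y ≡ f y) →
      Goal ⊎ (q ∉ I × (∀ {y} → y ∈ J → t y ≡ f y))
    settle {t} {q} T ag with q ∈? I
    ... | yes q∈ = inj₁ (t , q , q∈ , T , ag)
    ... | no q∉ = inj₂ (q∉ , ag)
    search (suc D) {t} {q} T (s≤s ≤D) with t a ≟ q
    ... | yes ta = settle T λ y∈ → unique (d≤-del a∈ d<) (tope-del (good-pos g) a∈ ta T) F (J⊆ y∈)
    ... | no ta≢q with move (good-pos g) d< T a∈ F ta≢q
    ... | mv with search D (Move.next-tope mv) (≤-trans (Move.decreases mv) ≤D)
    ...   | inj₁ found = inj₁ found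
    -- This move changes only an element that `f` sends to the next right node. That node is outside
    -- `I`, so the element is not in `J`.
    ...   | inj₂ (q₁∉ , ag) = settle T λ {y} y∈ → trans
              (Move.next-agrees mv (∈-∖ (∖⊆ (J⊆ y∈)) λ { refl → q₁∉ (J→I y∈) })) (ag y∈)
    start : Extension J K I f
    start with linked d< u (good-pos g) (trans (∣∖∣ K a∈) (cong suc (∣K∣≡Σcnt (K ∖ a) f))) c
    ... | t , T , _ with search _ T ≤-refl
    ... | inj₂ (c∉ , _) = contradiction c∈ c∉
    ... | inj₁ (f′ , s , s∈ , (g′ , ty) , ag) = f′ , g′ , ag , λ e e∉ →
      subst (_≤ 1) (sym (trans (ty e) (bump-other u λ { refl → e∉ s∈ }))) (th e e∉)

  extend-to-full : ∀ e {S f J I} → e + ∣ S ∣ ≡ n → Good S f → J ⊆ S → (∀ {y} → y ∈ J → f y ∈ I) →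
    (∃ λ c → c ∈ I) → (∀ c → c ∉ I → cnt S f c ≤ 1) →
    Extension J Full I f
  extend-to-full zero {S} {f} e≡ g J⊆ J→I ne th with ∣p∣≡n⇒p≡⊤ {p = S} e≡
  ... | refl = f , g , (λ _ → refl) , th
  extend-to-full (suc e) {S} {f} {J} {I} e≡ g J⊆ J→I ne th
    with outsider Full S (subst (∣ S ∣ <_) (trans e≡ (sym (∣⊤∣≡n n))) (s≤s (m≤n+m ∣ S ∣ e)))
  ... | a , _ , a∉ = further (extend d< (inserted a) (subst (λ R → Good R f) (sym K∖a) g)
          (λ y∈ → subst (_ ∈_) (sym K∖a) (J⊆ y∈)) J→I ne
          (subst (λ R → ∀ c → c ∉ I → cnt R f c ≤ 1) (sym K∖a) th))
    where
    K = S ∪ ⁅ a ⁆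
    K∖a = insert-∖ a∉
    ∣K∣ = ∣insert∣ a∉
    d< : d < ∣ K ∣
    d< = subst (d <_) (sym ∣K∣) (s≤s (good-size g))
    further : Extension J K I f → Extension J Full I f
    further (f₁ , g₁ , ag₁ , th₁)
      with extend-to-full e (trans (cong (e +_) ∣K∣) (trans (+-suc e ∣ S ∣) e≡)) g₁
        (λ y∈ → x∈p∪q⁺ (inj₁ (J⊆ y∈))) (λ y∈ → subst (_∈ I) (sym (ag₁ y∈)) (J→I y∈)) ne th₁
    ... | f₂ , g₂ , ag₂ , th₂ = f₂ , g₂ , (λ y∈ → trans (ag₂ y∈) (ag₁ y∈)) , th₂

  -- Let `J′` be the part of `J` where `t` and `m σ` differ and `I` its image under `t`. By `image`
  -- and injectivity, `m σ` maps `J′` into `I` as well. So it extends to a good tope on all of L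
  -- with the same values on `J′`, which is in conflict with `t` on `I`.
  good⇒compatible : ∀ {t σ J} → Good Full t → ∣ σ ∣ ≡ d → J ⊆ σ →
    (∀ {y} → y ∈ J → ∃ λ y′ → y′ ∈ J × t y′ ≡ m σ y) → ∀ {y} → y ∈ J → t y ≡ m σ y
  good⇒compatible {t} {σ} {J} g ∣σ∣ J⊆ image {y₀} y₀∈ = decidable-stable (t y₀ ≟ m σ y₀) λ ne → absurd ne
    where
    Moved : Fin d → Set
    Moved c = ∃ λ y → y ∈ J × t y ≡ c × m σ y ≢ c
    moved? : ∀ c → Dec (Moved c)
    moved? c = any? λ y → (y ∈? J) ×-dec ((t y ≟ c) ×-dec ¬? (m σ y ≟ c))
    I = sep moved?
    J′ : Subset n
    J′ = mismatch J t (m σ)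
    J′→I : ∀ {y} → y ∈ J′ → m σ y ∈ I
    J′→I y∈ with ∈-mismatch⁻ y∈
    ... | y∈J , ty≢ with image y∈J
    ... | y′ , y′∈ , ty′ = ∈-sep⁺ moved? (y′ , y′∈ , ty′ , λ my′ →
      ty≢ (subst (λ z → t z ≡ m σ z) (onto-injective ∣σ∣ (m-onto ∣σ∣) (J⊆ y′∈) (J⊆ y∈J) my′) (trans ty′ (sym my′))))
    absurd : t y₀ ≢ m σ y₀ → ⊥
    absurd ne with extend-to-full (n ∸ ∣ σ ∣) {J = J′} {I} (m∸n+n≡m (∣p∣≤n σ)) (good-base ∣σ∣)
        (λ y∈ → J⊆ (proj₁ (∈-mismatch⁻ y∈))) J′→I (_ , c∈)
        (λ c _ → ≤-reflexive (Σ≡d⇒all-one (cnt σ (m σ)) (good-pos (good-base ∣σ∣))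
          (trans (sym (∣K∣≡Σcnt σ (m σ))) ∣σ∣) c))
      where
      c∈ : t y₀ ∈ I
      c∈ = ∈-sep⁺ moved? (y₀ , y₀∈ , refl , ne ∘ sym)
    ... | f , gf , ag , th = no-conflict (n ∸ d) _ {Full} {t} {f} {I}
      (trans (∣⊤∣≡n n) (sym (m∸n+n≡m d≤n))) refl (_ , ∈-sep⁺ moved? (y₀ , y₀∈ , refl , ne ∘ sym))
      (conflict g gf th λ c∈ → let y , y∈ , ty , my = ∈-sep⁻ moved? c∈ in
        y , ∈⊤ , ty , λ fy → my (trans (sym (ag (∈-mismatch⁺ y∈ λ e → my (trans (sym e) ty)))) fy))
      where
      d≤n : d ≤ n
      d≤n = subst (_≤ n) ∣σ∣ (∣p∣≤n σ)

-- Linkage trees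

lookup-injective : {A : Set} {xs : List A} → UniqueList xs →
  ∀ {i j} → List.lookup xs i ≡ List.lookup xs j → i ≡ j
lookup-injective (_ ∷ _) {zero} {zero} _ = refl
lookup-injective {xs = _ ∷ xs} (x≢ ∷ _) {zero} {suc j} e = contradiction e (All.lookup x≢ (∈-lookup j))
lookup-injective {xs = _ ∷ xs} (x≢ ∷ _) {suc i} {zero} e = contradiction (sym e) (All.lookup x≢ (∈-lookup i))
lookup-injective (_ ∷ uq) {suc i} {suc j} e = cong suc (lookup-injective uq e)

vertices-bounded : {xs : List (Vertex n d)} → UniqueList xs → length xs ≤ n + d
vertices-bounded {n} {d} {xs} uq = injective⇒≤ {f = λ i → join n d (List.lookup xs i)} λ {i} {j} e →
  lookup-injective uq (trans (sym (splitAt-join n d (List.lookup xs i)))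
    (trans (cong (splitAt n) e) (splitAt-join n d (List.lookup xs j))))

module Acyclic {n d : ℕ} {E : ERel n d} (acyclic : ¬ HasCycle E) where

  segment : ∀ {a v xs} → Chain E (a ∷ xs) → UniqueList (a ∷ xs) → v ∈ₗ xs →
    Σ (List (Vertex n d)) λ as → Chain E (a ∷ as ++ [ v ]) × UniqueList (a ∷ as) ×
      All (v ≢_) (a ∷ as) × (∀ {P : Vertex n d → Set} → All P xs → All P as)
  segment (cons adj _) ((a≢x ∷ _) ∷ _) (here refl) =
    [] , cons adj one , [] ∷ [] , (a≢x ∘ sym) ∷ [] , λ _ → []
  segment (cons adj ch) ((a≢x ∷ a≢) ∷ uq) (there v∈) with segment ch uq v∈
  ... | as , ch′ , uq′ , v≢ , sub = _ ∷ as , cons adj ch′ , (a≢x ∷ sub a≢) ∷ uq′ ,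
    (λ v≡a → All.lookup a≢ v∈ (sym v≡a)) ∷ v≢ , λ { (p ∷ ps) → p ∷ sub ps }

  adj⇒≢ : ∀ {u v} → Adj E u v → u ≢ v
  adj⇒≢ {inj₁ _} {inj₁ _} () refl
  adj⇒≢ {inj₂ _} {inj₂ _} () refl

  -- Meeting an earlier vertex would close a cycle, with at least three vertices because the walk
  -- does not turn back.
  cons-unique : ∀ {v u w ws} → Adj E v u → Chain E (u ∷ w ∷ ws) → UniqueList (u ∷ w ∷ ws) → v ≢ w →
    UniqueList (v ∷ u ∷ w ∷ ws)
  cons-unique {v} {u} {w} {ws} adj (cons adj′ ch) uq@((u≢w ∷ u≢) ∷ uq′) v≢w =
    (adj⇒≢ adj ∷ v≢w ∷ All.tabulate λ {x} x∈ v≡x → cycle (subst (_∈ₗ ws) (sym v≡x) x∈)) ∷ uq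
    where
    cycle : v ∈ₗ ws → ⊥
    cycle v∈ with segment ch uq′ v∈
    ... | as , ch′ , uq″ , v≢ , sub = acyclic (v , u ∷ w ∷ as , s≤s (s≤s z≤n) ,
      (adj⇒≢ adj ∷ v≢) ∷ (u≢w ∷ sub u≢) ∷ uq″ , cons adj (cons adj′ ch′))

  -- Each continuation prolongs a path by two new vertices, but a path has at most `n + d` of them.
  -- The uses of acyclicity below all take this form.
  no-infinite-walk : (P : Fin n → Fin d → Set) →
    (∀ {z r} → P z r → ∃ λ z′ → ∃ λ r′ → E z r′ × r′ ≢ r × E z′ r′ × z′ ≢ z × P z′ r′) →
    ∀ {z r} → E z r → ¬ P z r
  no-infinite-walk P next {z} {r} e p =
    go (suc (n + d)) (s≤s (m≤m+n (n + d) 2)) p (cons e one) (((λ ()) ∷ []) ∷ [] ∷ [])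
    where
    go : ∀ k {z r ws} → n + d < k + length (inj₁ z ∷ inj₂ r ∷ ws) → P z r →
      Chain E (inj₁ z ∷ inj₂ r ∷ ws) → UniqueList (inj₁ z ∷ inj₂ r ∷ ws) → ⊥
    go zero long _ _ uq = <⇒≱ long (vertices-bounded uq)
    go (suc k) {z} {r} {ws} long p ch uq with next p
    ... | z′ , r′ , zr′ , r′≢r , z′r′ , z′≢z , p′ =
      go k (≤-trans long (≤-trans (≤-reflexive (sym (+-suc k _))) (+-monoʳ-≤ k (n≤1+n _)))) p′
        (cons z′r′ ch₁) (cons-unique z′r′ ch₁ uq₁ (z′≢z ∘ inj₁-injective))
      where
      ch₁ : Chain E (inj₂ r′ ∷ inj₁ z ∷ inj₂ r ∷ ws)
      ch₁ = cons zr′ ch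
      uq₁ = cons-unique {inj₂ r′} zr′ ch uq (r′≢r ∘ inj₂-injective)

module TreeBase {n d : ℕ} (m : Subset n → Fin n → Fin d)
  (m-onto : ∀ {σ} → ∣ σ ∣ ≡ d → Onto σ (m σ))
  (E : Subset n → ERel n d)
  (acyclic : ∀ {τ} → ∣ τ ∣ ≡ suc d → ¬ HasCycle (E τ))
  (E-intro : ∀ {τ x z r} → ∣ τ ∣ ≡ suc d → x ∈ τ → z ∈ τ ∖ x → m (τ ∖ x) z ≡ r → E τ z r) where

  open Topes m m-onto

  module _ {τ : Subset n} (∣τ∣ : ∣ τ ∣ ≡ suc d) where
    open Acyclic (acyclic {τ} ∣τ∣)

    f : Fin n → Fin n → Fin d
    f x = m (τ ∖ x)

    size : ∀ {x} → x ∈ τ → ∣ τ ∖ x ∣ ≡ d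
    size x∈ = ∣∖∣-pred x∈ ∣τ∣

    f-inj : ∀ {x y z} → x ∈ τ → y ∈ τ ∖ x → z ∈ τ ∖ x → f x y ≡ f x z → y ≡ z
    f-inj x∈ = onto-injective (size x∈) (m-onto (size x∈))

    -- A third neighbour `p′` of `r` would allow an endless walk without turning back: a left node
    -- `z` other than `p` is left along its edge in the matching of `τ ∖ p`, a right node other than
    -- `r`, reached from `z`, along its edge in the matching of `τ ∖ z`; `p` leads to `r`, and `r`
    -- to `p′`.
    two-neighbours : ∀ {p c p′ r} → p ∈ τ → c ∈ τ ∖ p → p′ ∈ τ → E τ p r → f p c ≡ r → E τ p′ r →
      p′ ≡ p ⊎ p′ ≡ c
    two-neighbours {p} {c} {p′} {r} p∈ c∈ p′∈ pr fc p′r with p′ ≟ p | p′ ≟ c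
    ... | yes e | _ = inj₁ e
    ... | _ | yes e = inj₂ e
    ... | no p′≢p | no p′≢c = contradiction start (no-infinite-walk P next p′r)
      where
      P : Fin n → Fin d → Set
      P z s = z ∈ τ × (z ≢ p → f p z ≢ s) × (z ≡ p → s ≢ r)
      start : P p′ r
      start = p′∈ , (λ _ e → p′≢c (f-inj p∈ (∈-∖ p′∈ p′≢p) c∈ (trans e (sym fc)))) , λ e → contradiction e p′≢p
      next : ∀ {z s} → P z s → ∃ λ z′ → ∃ λ s′ → E τ z s′ × s′ ≢ s × E τ z′ s′ × z′ ≢ z × P z′ s′
      next {z} {s} (z∈ , off , at) with z ≟ p
      ... | yes refl = p′ , r , pr , at refl ∘ sym , p′r , p′≢p , start
      ... | no z≢p with f p z ≟ r
      ...   | yes fz = p′ , r , subst (E τ z) fz zf , (λ e → off z≢p (trans fz e)) , p′r ,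
                (λ p′≡z → p′≢c (trans p′≡z (f-inj p∈ z∈′ c∈ (trans fz (sym fc))))) , start
        where
        z∈′ = ∈-∖ z∈ z≢p
        zf = E-intro ∣τ∣ p∈ z∈′ refl
      ...   | no fz≢r with m-onto (size z∈) (f p z)
      ...     | z′ , z′∈ , fz′ = z′ , f p z , E-intro ∣τ∣ p∈ (∈-∖ z∈ z≢p) refl , off z≢p ,
                  E-intro ∣τ∣ z∈ z′∈ fz′ , ∈∖⇒≢ z′∈ , ∖⊆ z′∈ ,
                  (λ z′≢p e → ∈∖⇒≢ z′∈ (f-inj p∈ (∈-∖ (∖⊆ z′∈) z′≢p) (∈-∖ z∈ z≢p) e)) , λ _ → fz≢r

    -- A `z` where the matchings of `τ ∖ a` and `τ ∖ b` differ would start an endless walk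
    -- alternating between them; it cannot run into `a` or `b`, which are matched to the same `r`.
    agree-off : ∀ {a b r} → a ∈ τ ∖ b → b ∈ τ ∖ a → f a b ≡ r → f b a ≡ r →
      ∀ {z} → z ∈ τ → z ≢ a → z ≢ b → f a z ≡ f b z
    agree-off {a} {b} {r} a∈ b∈ fab fba {z} z∈ z≢a z≢b with f a z ≟ f b z
    ... | yes e = e
    ... | no ne = contradiction (z∈ , z≢a , z≢b , refl , ne)
        (no-infinite-walk P next (E-intro ∣τ∣ (∖⊆ b∈) (∈-∖ z∈ z≢b) refl))
      where
      P : Fin n → Fin d → Set
      P z s = z ∈ τ × z ≢ a × z ≢ b × f b z ≡ s × f a z ≢ s
      next : ∀ {z s} → P z s → ∃ λ z′ → ∃ λ s′ → E τ z s′ × s′ ≢ s × E τ z′ s′ × z′ ≢ z × P z′ s′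
      next {z} {s} (z∈ , z≢a , z≢b , fbz , faz) with m-onto (size (∖⊆ b∈)) (f a z)
      ... | z′ , z′∈ , fz′ = z′ , f a z , E-intro ∣τ∣ (∖⊆ a∈) (∈-∖ z∈ z≢a) refl , faz ,
              E-intro ∣τ∣ (∖⊆ b∈) z′∈ fz′ , z′≢z , ∖⊆ z′∈ , z′≢a , ∈∖⇒≢ z′∈ , fz′ ,
              λ e → z′≢z (f-inj (∖⊆ a∈) (∈-∖ (∖⊆ z′∈) z′≢a) (∈-∖ z∈ z≢a) e)
        where
        z′≢z : z′ ≢ z
        z′≢z refl = faz (trans (sym fz′) fbz)
        z′≢a : z′ ≢ a
        z′≢a refl = z≢b (f-inj (∖⊆ a∈) (∈-∖ z∈ z≢a) b∈ (trans (sym fz′) (trans fba (sym fab))))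

    -- The node `r` has exactly two neighbours: `a`, its partner in some matching, and `b`, its
    -- partner in the matching of `τ ∖ a`. Its partner in that of `τ ∖ b` must then be `a` again. So
    -- the matching of `τ ∖ a` with `a` sent to `r` equals that of `τ ∖ b` with `b` sent to `r`, and
    -- this is the orientation towards `r`.
    linked-at : Linked τ
    linked-at u 1≤u e r with inhabited {p = τ} (subst (1 ≤_) (sym ∣τ∣) (s≤s z≤n))
    ... | x₀ , x₀∈ with m-onto (size x₀∈) r
    ... | a , a∈₀ , fa with m-onto (size (∖⊆ a∈₀)) r
    ... | b , b∈ , fab with m-onto (size (∖⊆ b∈)) r
    ... | c , c∈ , fbc = T , (good-T , type-T) , absorbs
      where
      a∈τ = ∖⊆ a∈₀
      b∈τ = ∖⊆ b∈
      ar = E-intro ∣τ∣ x₀∈ a∈₀ fa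
      only : ∀ {z} → z ∈ τ → E τ z r → z ≡ a ⊎ z ≡ b
      only z∈ zr = two-neighbours a∈τ b∈ z∈ ar fab zr
      c≡a : c ≡ a
      c≡a with only (∖⊆ c∈) (E-intro ∣τ∣ b∈τ c∈ fbc)
      ... | inj₁ c≡a = c≡a
      ... | inj₂ c≡b = contradiction c≡b (∈∖⇒≢ c∈)
      a∈ : a ∈ τ ∖ b
      a∈ = subst (_∈ τ ∖ b) c≡a c∈
      fba : f b a ≡ r
      fba = trans (cong (f b) (sym c≡a)) fbc
      T : Fin n → Fin d
      T z with z ≟ a
      ... | yes _ = r
      ... | no _ = f a z
      Ta : T a ≡ r
      Ta with a ≟ a
      ... | yes _ = refl
      ... | no a≢a = contradiction refl a≢a
      on-a : ∀ {z} → z ∈ τ ∖ a → f a z ≡ T z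
      on-a {z} z∈ with z ≟ a
      ... | yes z≡a = contradiction z≡a (∈∖⇒≢ z∈)
      ... | no _ = refl
      on-b : ∀ {z} → z ∈ τ ∖ b → f b z ≡ T z
      on-b {z} z∈ with z ≟ a
      ... | yes refl = fba
      ... | no z≢a = sym (agree-off a∈ b∈ fab fba (∖⊆ z∈) z≢a (∈∖⇒≢ z∈))
      Tb : T b ≡ r
      Tb = trans (sym (on-a b∈)) fab
      Σu : ∀ {x} → x ∈ τ → ∣ τ ∖ x ∣ ≡ Σ′ u
      Σu x∈ = ∣∖∣-pred x∈ e
      good-T : Good τ T
      good-T = good-ext a∈τ b∈τ (∈∖⇒≢ b∈) (trans Tb (sym Ta))
        (good-cong on-a (good-base (size a∈τ))) (good-cong on-b (good-base (size b∈τ)))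
      type-T : HasType τ T (bump u r)
      type-T = type-add {t = T} a∈τ Ta
        (proj₂ (tope-cong on-a (proj₂ (exists-base (size a∈τ) u 1≤u (Σu a∈τ)))))
      absorbs : Absorbs τ u r T
      absorbs {x} x∈ F {z} z∈ fz with only (∖⊆ z∈)
        (E-intro ∣τ∣ x∈ z∈ (trans (base-agree (size x∈) (good-base (size x∈)) (proj₁ F) z∈) fz))
      ... | inj₁ refl = Ta
      ... | inj₂ refl = Tb

-- Graphs as partial functions

vec-ext : {A : Set} {xs ys : Vec A n} → (∀ i → lookup xs i ≡ lookup ys i) → xs ≡ ys
vec-ext {xs = xs} {ys} e = trans (sym (tabulate∘lookup xs)) (trans (tabulate-cong e) (tabulate∘lookup ys))

∣∣≡1⁻ : {p : Subset n} → ∣ p ∣ ≡ 1 → ∃ λ x → x ∈ p × (∀ {z} → z ∈ p → z ≡ x)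
∣∣≡1⁻ {p = p} e with inhabited {p = p} (≤-reflexive (sym e))
... | x , x∈ = x , x∈ , λ {z} z∈ → decidable-stable (z ≟ x) λ z≢x → <⇒≢ (2≤∣∣ x∈ z∈ z≢x) (sym e)

∣∣≡1⁺ : {p : Subset n} {x : Fin n} → x ∈ p → (∀ {z} → z ∈ p → z ≡ x) → ∣ p ∣ ≡ 1
∣∣≡1⁺ {x = x} x∈ only = trans (cong ∣_∣ (⊆-antisym (λ z∈ → subst (_∈ ⁅ x ⁆) (sym (only z∈)) (x∈⁅x⁆ x))
  (λ z∈ → subst (_∈ _) (sym (x∈⁅y⁆⇒x≡y x z∈)) x∈))) (∣⁅x⁆∣≡1 x)

record Represents (G : Graph n d) (K : Subset n) (t : Fin n → Fin d) : Set where
  field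
    edge : ∀ {i} → i ∈ K → Edge G i (t i)
    domain : ∀ {i j} → Edge G i j → i ∈ K
    value : ∀ {i j} → Edge G i j → t i ≡ j
open Represents

graphOf : Subset n → (Fin n → Fin d) → Graph n d
graphOf K t = tabulate λ i → sep (λ j → (i ∈? K) ×-dec (t i ≟ j))

graphOf-represents : (K : Subset n) (t : Fin n → Fin d) → Represents (graphOf K t) K t
graphOf-represents K t = record
  { edge = λ {i} i∈ → subst (t i ∈_) (sym (lookup∘tabulate _ i)) 
      (∈-sep⁺ (λ j → (i ∈? K) ×-dec (t i ≟ j)) (i∈ , refl))
  ; domain = λ e → proj₁ (unfold e)
  ; value = λ e → proj₂ (unfold e) }
  where
  unfold : ∀ {i j} → Edge (graphOf K t) i j → i ∈ K × t i ≡ j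
  unfold {i} {j} e = ∈-sep⁻ (λ j → (i ∈? K) ×-dec (t i ≟ j)) (subst (j ∈_) (lookup∘tabulate _ i) e)

represents-⊆ : {G H : Graph n d} {J K : Subset n} {s t : Fin n → Fin d} → Represents G J s → Represents H K t →
  (∀ {i} → i ∈ J → i ∈ K × s i ≡ t i) → G ⊆G H
represents-⊆ {H = H} rG rH e i j ij with e (domain rG ij)
... | i∈K , si = subst (Edge H i) (trans (sym si) (value rG ij)) (edge rH i∈K)

represents-≡ : {G H : Graph n d} {K : Subset n} {s t : Fin n → Fin d} → Represents G K s → Represents H K t →
  (∀ {i} → i ∈ K → s i ≡ t i) → G ≡ H
represents-≡ rG rH e = vec-ext λ i → ⊆-antisym
  (λ {j} → represents-⊆ rG rH (λ i∈ → i∈ , e i∈) i j) (λ {j} → represents-⊆ rH rG (λ i∈ → i∈ , sym (e i∈)) i j)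

⊆G-agree : {G H : Graph n d} {J K : Subset n} {s t : Fin n → Fin d} → Represents G J s → Represents H K t →
  G ⊆G H → ∀ {i} → i ∈ J → i ∈ K × t i ≡ s i
⊆G-agree {s = s} rG rH sub {i} i∈ = let e = sub i (s i) (edge rG i∈) in domain rH e , value rH e

column : Graph n d → Fin d → Subset n
column G j = Vec.map (λ row → lookup row j) G

∈-column⁺ : (G : Graph n d) {i : Fin n} {j : Fin d} → Edge G i j → i ∈ column G j
∈-column⁺ G {i} {j} e = lookup⇒[]= i _ (trans (lookup-map i _ G) ([]=⇒lookup e))

∈-column⁻ : (G : Graph n d) {i : Fin n} {j : Fin d} → i ∈ column G j → Edge G i j
∈-column⁻ G {i} {j} i∈ = lookup⇒[]= j _ (trans (sym (lookup-map i _ G)) ([]=⇒lookup i∈))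

rdeg≡cnt : {G : Graph n d} {K : Subset n} {t : Fin n → Fin d} → Represents G K t → ∀ j → rdeg G j ≡ cnt K t j
rdeg≡cnt {G = G} {K} {t} r j = cong ∣_∣ (⊆-antisym {i = column G j} {fibre K t j}
  (λ i∈ → let e = ∈-column⁻ G i∈ in ∈-fibre⁺ (domain r e) (value r e))
  (λ {i} i∈ → let i∈K , ti = ∈-fibre⁻ i∈ in ∈-column⁺ G (subst (Edge G i) ti (edge r i∈K))))

record Bijective (J : Subset n) (t : Fin n → Fin d) (I : Subset d) : Set where
  field
    maps : ∀ {i} → i ∈ J → t i ∈ I
    injective : ∀ {i k} → i ∈ J → k ∈ J → t i ≡ t k → i ≡ k
    surjective : ∀ {j} → j ∈ I → ∃ λ i → i ∈ J × t i ≡ j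
open Bijective

matching⁺ : {M : Graph n d} {J : Subset n} {I : Subset d} {t : Fin n → Fin d} →
  Represents M J t → Bijective J t I → IsPerfectMatchingOn M J I
matching⁺ {M = M} {J} {I} {t} r b = (λ i j e → domain r e , subst (_∈ I) (value r e) (maps b (domain r e))) ,
  (λ i i∈ → ∣∣≡1⁺ (edge r i∈) λ e → sym (value r e)) ,
  λ j j∈ → let i , i∈ , ti = surjective b j∈ in
    ∣∣≡1⁺ {p = column M j} (∈-column⁺ M (subst (Edge M i) ti (edge r i∈))) λ k∈ → let e = ∈-column⁻ M k∈ in
      injective b (domain r e) i∈ (trans (value r e) (sym ti))

module _ (r₀ : Fin d) where

  -- Rows without an edge get the junk value r₀.
  function : Graph n d → Fin n → Fin d
  function G i with nonempty? (lookup G i)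
  ... | yes (j , _) = j
  ... | no _ = r₀

  function-represents : {G : Graph n d} {K : Subset n} →
    (∀ {i j} → Edge G i j → i ∈ K) → (∀ {i} → i ∈ K → ldeg G i ≡ 1) →
    Represents G K (function G)
  function-represents {G = G} {K} dom deg = record
    { edge = λ i∈ → edge′ (inhabited (≤-reflexive (sym (deg i∈)))) ; domain = dom ; value = val }
    where
    edge′ : ∀ {i} → (∃ λ j → Edge G i j) → Edge G i (function G i)
    edge′ {i} (j , e) with nonempty? (lookup G i)
    ... | yes (_ , e′) = e′
    ... | no none = contradiction (j , e) none
    val : ∀ {i j} → Edge G i j → function G i ≡ j
    val {i} e with ∣∣≡1⁻ (deg (dom e))
    ... | _ , _ , only = trans (only (edge′ (_ , e))) (sym (only e))

  matching⁻ : {M : Graph n d} {J : Subset n} {I : Subset d} → IsPerfectMatchingOn M J I →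
    Represents M J (function M) × Bijective J (function M) I
  matching⁻ {M = M} {J} {I} (ends , left , right) = r , record
    { maps = λ i∈ → proj₂ (ends _ _ (edge r i∈))
    ; injective = λ {i} {k} i∈ k∈ e →
        let _ , _ , only = ∣∣≡1⁻ {p = column M (function M i)} (right _ (proj₂ (ends _ _ (edge r i∈)))) in
        trans (only (∈-column⁺ M (edge r i∈))) (sym (only (∈-column⁺ M (subst (Edge M k) (sym e) (edge r k∈)))))
    ; surjective = λ {j} j∈ → let i , i∈ , _ = ∣∣≡1⁻ {p = column M j} (right j j∈)
                                  e = ∈-column⁻ M i∈ in i , proj₁ (ends i j e) , value r e }
    where
    r = function-represents (λ e → proj₁ (ends _ _ e)) (λ i∈ → left _ i∈)

  maximal⁻ : {T : Graph n d} → IsMaximalTope T → Represents T Full (function T) × Onto Full (function T)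
  maximal⁻ {n} {T = T} (ldeg≡ , pos) = r , λ j →
      fibre-elt {K = Full} {function T} (subst (1 ≤_) (rdeg≡cnt r j) (pos j))
    where
    deg : ∀ i → ldeg T i ≡ 1
    deg i = trans (sym (lookup∘tabulate (ldeg T) i)) (trans (cong (λ v → lookup v i) ldeg≡)
      (trans (lookup-map i _ (Full {n})) (cong (λ b → if b then 1 else 0) (lookup-replicate i inside))))
    r = function-represents (λ _ → ∈⊤) (λ {i} _ → deg i)

maximal⁺ : {T : Graph n d} {t : Fin n → Fin d} → Represents T Full t → Onto Full t → IsMaximalTope T
maximal⁺ {n} {T = T} {t} r on = vec-ext (λ i → trans (lookup∘tabulate (ldeg T) i) (trans (deg i)
    (sym (trans (lookup-map i _ (Full {n})) (cong (λ b → if b then 1 else 0) (lookup-replicate i inside)))))) ,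
  λ j → let _ , i∈ , ti = on j in subst (1 ≤_) (sym (rdeg≡cnt r j)) (∈⇒1≤∣∣ (∈-fibre⁺ i∈ ti))
  where
  deg : ∀ i → ldeg T i ≡ 1
  deg i = ∣∣≡1⁺ (edge r ∈⊤) λ e → sym (value r e)

-- A matching inside the graph of a partial function is a restriction of that function, so the
-- vertex sets determine it.
CompatibleOn : Subset n → (Fin n → Fin d) → Subset n → (Fin n → Fin d) → Set
CompatibleOn {n} {d} A s B t = ∀ {J : Subset n} {I : Subset d} → J ⊆ A → J ⊆ B →
  Bijective J s I → Bijective J t I → ∀ {y} → y ∈ J → s y ≡ t y

compatible⁻ : {F G : Graph n d} {A B : Subset n} {s t : Fin n → Fin d} → Represents F A s → Represents G B t →
  Compatible F G → CompatibleOn A s B t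
compatible⁻ {s = s} {t} rF rG c {J} {I} J⊆A J⊆B bs bt {y} y∈ =
  trans (sym refl) (sym (value (graphOf-represents J t) (subst (λ M → Edge M y (s y))
    (c J I (graphOf J s) (graphOf J t)
      (matching⁺ (graphOf-represents J s) bs , represents-⊆ (graphOf-represents J s) rF (λ i∈ → J⊆A i∈ , refl))
      (matching⁺ (graphOf-represents J t) bt , represents-⊆ (graphOf-represents J t) rG (λ i∈ → J⊆B i∈ , refl)))
    (edge (graphOf-represents J s) y∈))))

bijective-cong : {J : Subset n} {I : Subset d} {s t : Fin n → Fin d} →
  (∀ {i} → i ∈ J → s i ≡ t i) → Bijective J s I → Bijective J t I
bijective-cong {I = I} e b = record
  { maps = λ i∈ → subst (_∈ I) (e i∈) (maps b i∈)
  ; injective = λ i∈ k∈ ti → injective b i∈ k∈ (trans (e i∈) (trans ti (sym (e k∈))))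
  ; surjective = λ j∈ → let i , i∈ , si = surjective b j∈ in i , i∈ , trans (sym (e i∈)) si }

compatible⁺ : Fin d → {F G : Graph n d} {A B : Subset n} {s t : Fin n → Fin d} →
  Represents F A s → Represents G B t → CompatibleOn A s B t → Compatible F G
compatible⁺ r₀ {s = s} {t} rF rG c J I M N (pmM , M⊆) (pmN , N⊆) with matching⁻ r₀ pmM | matching⁻ r₀ pmN
... | rM , bM | rN , bN = represents-≡ rM rN λ i∈ → trans (sym (eM i∈)) (trans
    (c (λ i∈ → proj₁ (⊆G-agree rM rF M⊆ i∈)) (λ i∈ → proj₁ (⊆G-agree rN rG N⊆ i∈))
      (bijective-cong (λ i∈ → sym (eM i∈)) bM) (bijective-cong (λ i∈ → sym (eN i∈)) bN) i∈) (eN i∈))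
  where
  eM : ∀ {i} → i ∈ J → s i ≡ function r₀ M i
  eM i∈ = proj₂ (⊆G-agree rM rF M⊆ i∈)
  eN : ∀ {i} → i ∈ J → t i ≡ function r₀ N i
  eN i∈ = proj₂ (⊆G-agree rN rG N⊆ i∈)

onto⇒bijective : {σ : Subset n} {t : Fin n → Fin d} → ∣ σ ∣ ≡ d → Onto σ t → Bijective σ t Full
onto⇒bijective ∣σ∣ on = record
  { maps = λ _ → ∈⊤ ; injective = onto-injective ∣σ∣ on ; surjective = λ {j} _ → on j }

Σ′-∸1 : {v : Fin d → ℕ} → (∀ s → 1 ≤ v s) → d + Σ′ (λ s → v s ∸ 1) ≡ Σ′ v
Σ′-∸1 {zero} 1≤ = refl
Σ′-∸1 {suc d} {v} 1≤ = trans (cong suc swap)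
  (cong₂ _+_ (m+[n∸m]≡n (1≤ zero)) (Σ′-∸1 (λ s → 1≤ (suc s))))
  where
  rest = Σ′ (λ s → v (suc s) ∸ 1)
  swap : d + (v zero ∸ 1 + rest) ≡ v zero ∸ 1 + (d + rest)
  swap = trans (sym (+-assoc d (v zero ∸ 1) rest))
    (trans (cong (_+ rest) (+-comm d (v zero ∸ 1))) (+-assoc (v zero ∸ 1) d rest))

Σ′-suc : (v : Fin d → ℕ) → Σ′ (λ s → suc (v s)) ≡ d + Σ′ v
Σ′-suc v = sym (Σ′-∸1 {v = λ s → suc (v s)} (λ _ → s≤s z≤n))

module _ (T : Graph n d) where

  minusOnes-lookup : ∀ j → lookup (minusOnes (rdegVec T)) j ≡ rdeg T j ∸ 1
  minusOnes-lookup j = trans (lookup-map j _ (rdegVec T)) (cong (_∸ 1) (lookup∘tabulate (rdeg T) j))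

  sum-minusOnes : sumVec (minusOnes (rdegVec T)) ≡ Σ′ (λ j → rdeg T j ∸ 1)
  sum-minusOnes = cong Vec.sum (sym (tabulate-∘ (_∸ 1) (rdeg T)))

-- `σ` is the image of a section of `t` that takes its value in `J` wherever `J` meets the fibre.
transversal-through : {K J : Subset n} {t : Fin n → Fin d} → Onto K t → J ⊆ K →
  (∀ {i k} → i ∈ J → k ∈ J → t i ≡ t k → i ≡ k) →
  Σ (Subset n) λ σ → σ ⊆ K × J ⊆ σ × ∣ σ ∣ ≡ d × Onto σ t
transversal-through {n} {d} {K} {J} {t} on J⊆ inj = σ , σ⊆ , J⊆σ , ∣σ∣ , on-σ
  where
  section : ∀ r → ∃ λ z → z ∈ K × t z ≡ r × (∀ {y} → y ∈ J → t y ≡ r → z ≡ y)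
  section r with any? (λ y → (y ∈? J) ×-dec (t y ≟ r))
  ... | yes (y , y∈ , ty) = y , J⊆ y∈ , ty , λ y′∈ ty′ → inj y∈ y′∈ (trans ty (sym ty′))
  ... | no none = let z , z∈ , tz = on r in z , z∈ , tz , λ y∈ ty → contradiction (_ , y∈ , ty) none
  s : Fin d → Fin n
  s r = proj₁ (section r)
  ts : ∀ r → t (s r) ≡ r
  ts r = proj₁ (proj₂ (proj₂ (section r)))
  σ = sep (λ z → s (t z) ≟ z)
  s∈ : ∀ r → s r ∈ σ
  s∈ r = ∈-sep⁺ (λ z → s (t z) ≟ z) (cong s (ts r))
  σ⊆ : σ ⊆ K
  σ⊆ {z} z∈ = subst (_∈ K) (∈-sep⁻ (λ z → s (t z) ≟ z) z∈) (proj₁ (proj₂ (section (t z))))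
  J⊆σ : J ⊆ σ
  J⊆σ {y} y∈ = ∈-sep⁺ (λ z → s (t z) ≟ z) (proj₂ (proj₂ (proj₂ (section (t y)))) y∈ refl)
  on-σ : Onto σ t
  on-σ r = s r , s∈ r , ts r
  ∣σ∣ : ∣ σ ∣ ≡ d
  ∣σ∣ = trans (∣K∣≡Σcnt σ t) (trans (Σ′-cong λ r →
    ∣∣≡1⁺ (∈-fibre⁺ (s∈ r) (ts r)) λ z∈ → let z∈σ , tz = ∈-fibre⁻ z∈ in
      trans (sym (∈-sep⁻ (λ z → s (t z) ≟ z) z∈σ)) (cong s tz)) (Σ′-one {d}))

-- From linkage matching fields to tope arrangements

module FieldToArrangement {n d : ℕ} (r₀ : Fin d) (d≤n : d ≤ n) (𝓜 : Subset n → Graph n d)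
  (field-𝓜 : IsMatchingField 𝓜) (linkage : IsLinkage 𝓜) where

  m : Subset n → Fin n → Fin d
  m σ = function r₀ (𝓜 σ)

  m-represents : ∀ {σ} → ∣ σ ∣ ≡ d → Represents (𝓜 σ) σ (m σ)
  m-represents {σ} ∣σ∣ = proj₁ (matching⁻ r₀ (field-𝓜 σ ∣σ∣))

  m-onto : ∀ {σ} → ∣ σ ∣ ≡ d → Onto σ (m σ)
  m-onto {σ} ∣σ∣ r = surjective (proj₂ (matching⁻ r₀ (field-𝓜 σ ∣σ∣))) ∈⊤

  open Topes m m-onto

  abstract
    linked-base : LinkedLevel 0
    linked-base = TreeBase.linked-at m m-onto (UnionBelow 𝓜) (λ {τ} ∣τ∣ → proj₂ (proj₂ (linkage τ ∣τ∣)))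
      (λ {τ} {x} {z} ∣τ∣ x∈ z∈ e → let ∣τ∖x∣ = ∣∖∣-pred x∈ ∣τ∣ in
        τ ∖ x , ∖⊆ , ∣τ∖x∣ , subst (Edge (𝓜 (τ ∖ x)) z) e (edge (m-represents ∣τ∖x∣) z∈))

  open Stack linked-base
  open Compatibility m m-onto linked-base

  d≤∣Full∣ : d ≤ ∣ Full {n} ∣
  d≤∣Full∣ = subst (d ≤_) (sym (∣⊤∣≡n n)) d≤n

  compatible⇒good : ∀ {T} → CompatibleTopes 𝓜 T → Good Full (function r₀ T)
  compatible⇒good {T} (max , comp) with maximal⁻ r₀ {T = T} max
  ... | r , on = good on λ {σ} _ ∣σ∣ onσ z∈ → sym
    (compatible⁻ r (m-represents ∣σ∣) (comp σ ∣σ∣) (λ _ → ∈⊤) (λ z∈ → z∈)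
      (onto⇒bijective ∣σ∣ onσ) (onto⇒bijective ∣σ∣ (m-onto ∣σ∣)) z∈)

  good⇒CompatibleOn : ∀ {t σ} → Good Full t → ∣ σ ∣ ≡ d → CompatibleOn Full t σ (m σ)
  good⇒CompatibleOn g ∣σ∣ _ J⊆ bt bm = good⇒compatible g ∣σ∣ J⊆ λ y∈ → surjective bt (maps bm y∈)

  good⇒compatibleTope : ∀ {T t} → Represents T Full t → Good Full t → CompatibleTopes 𝓜 T
  good⇒compatibleTope r g = maximal⁺ r (onto g) , λ σ ∣σ∣ →
    compatible⁺ r₀ r (m-represents ∣σ∣) (good⇒CompatibleOn g ∣σ∣)

  -- On a transversal `σ` of `t` through `J`, `m σ` is `t`; so compatibility of `t′` with `m σ`
  -- suffices.
  good-pairwise : ∀ {t t′} → Good Full t → Good Full t′ → CompatibleOn Full t Full t′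
  good-pairwise {t} {t′} g g′ {J} {I} _ _ bt bt′ {y} y∈
    with transversal-through (onto g) (λ _ → ∈⊤) (injective bt)
  ... | σ , σ⊆ , J⊆ , ∣σ∣ , on = sym (trans
      (good⇒compatible g′ ∣σ∣ J⊆ (λ y∈ → surjective bt′ (subst (_∈ I) (sym (m≡t y∈)) (maps bt y∈))) y∈)
      (m≡t y∈))
    where
    m≡t : ∀ {y} → y ∈ J → m σ y ≡ t y
    m≡t y∈ = transversal g σ⊆ ∣σ∣ on (J⊆ y∈)

  arrangement : IsTopeArrangement n d (CompatibleTopes 𝓜)
  arrangement = (λ T → proj₁) , pairwise , total , unique-tope , exists-tope
    where
    rep : ∀ {T} → CompatibleTopes 𝓜 T → Represents T Full (function r₀ T)
    rep {T} c = proj₁ (maximal⁻ r₀ {T = T} (proj₁ c))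
    pairwise : ∀ T T′ → CompatibleTopes 𝓜 T → CompatibleTopes 𝓜 T′ → Compatible T T′
    pairwise T T′ c c′ = compatible⁺ r₀ {T} {T′} (rep {T} c) (rep {T′} c′)
      (good-pairwise (compatible⇒good {T} c) (compatible⇒good {T′} c′))
    total : ∀ T → CompatibleTopes 𝓜 T → sumVec (minusOnes (rdegVec T)) ≡ n ∸ d
    total T c = trans (sum-minusOnes T) (trans (sym (m+n∸m≡n d _)) (cong (_∸ d)
      (trans (Σ′-∸1 (proj₂ (proj₁ c))) (trans (Σ′-cong (rdeg≡cnt (rep {T} c)))
        (trans (sym (∣K∣≡Σcnt (Full {n}) (function r₀ T))) (∣⊤∣≡n n))))))
    unique-tope : ∀ T T′ → CompatibleTopes 𝓜 T → CompatibleTopes 𝓜 T′ →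
      minusOnes (rdegVec T) ≡ minusOnes (rdegVec T′) → T ≡ T′
    unique-tope T T′ c c′ e = represents-≡ (rep {T} c) (rep {T′} c′)
      (unique d≤∣Full∣ (compatible⇒good {T} c , λ s → trans (sym (rdeg≡cnt (rep {T} c) s)) (same s))
        (compatible⇒good {T′} c′ , λ s → sym (rdeg≡cnt (rep {T′} c′) s)))
      where
      same : ∀ s → rdeg T s ≡ rdeg T′ s
      same s = ∸-cancelʳ-≡ (proj₂ (proj₁ c) s) (proj₂ (proj₁ c′) s)
        (trans (sym (minusOnes-lookup T s)) (trans (cong (λ v → lookup v s) e) (minusOnes-lookup T′ s)))
    exists-tope : ∀ w → sumVec w ≡ n ∸ d → Σ (Graph n d) λ T → CompatibleTopes 𝓜 T × minusOnes (rdegVec T) ≡ w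
    exists-tope w Σw with exists d≤∣Full∣ (λ s → suc (lookup w s)) (λ _ → s≤s z≤n)
      (sym (trans (Σ′-suc (lookup w)) (trans (cong (d +_) (trans (cong Vec.sum (tabulate∘lookup w)) Σw))
        (trans (m+[n∸m]≡n d≤n) (sym (∣⊤∣≡n n))))))
    ... | t , g , ty = graphOf Full t , good⇒compatibleTope (graphOf-represents Full t) g , vec-ext λ j →
      trans (minusOnes-lookup (graphOf Full t) j)
        (cong (_∸ 1) (trans (rdeg≡cnt (graphOf-represents Full t) j) (ty j)))

-- From tope arrangements to linkage matching fields

deletion-induction : (P : Subset n → Set) → P Full → (∀ {K x} → x ∈ K → P K → P (K ∖ x)) → ∀ S → P S
deletion-induction {n} P full del S = go (n ∸ ∣ S ∣) (m∸n+n≡m (∣p∣≤n S))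
  where
  go : ∀ e {S} → e + ∣ S ∣ ≡ n → P S
  go zero {S} e≡ = subst P (sym (∣p∣≡n⇒p≡⊤ {p = S} e≡)) full
  go (suc e) {S} e≡ with outsider Full S (subst (∣ S ∣ <_) (trans e≡ (sym (∣⊤∣≡n n))) (s≤s (m≤n+m ∣ S ∣ e)))
  ... | a , _ , a∉ = subst P (insert-∖ a∉)
    (del (inserted a) (go e (trans (cong (e +_) (∣insert∣ a∉)) (trans (+-suc e ∣ S ∣) e≡))))

-- The digraph of two compatible maps

Σ′-squeeze : {u v : Fin d → ℕ} → (∀ s → u s ≤ v s) → Σ′ v ≤ Σ′ u → ∀ s → v s ≤ u s
Σ′-squeeze {suc d} {u} {v} u≤v Σ≤ zero = +-cancelʳ-≤ (Σ′ (v ∘ suc)) _ _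
  (≤-trans Σ≤ (+-monoʳ-≤ (u zero) (Σ′-mono (u≤v ∘ suc))))
Σ′-squeeze {suc d} {u} {v} u≤v Σ≤ (suc s) = Σ′-squeeze (u≤v ∘ suc)
  (+-cancelˡ-≤ (v zero) _ _ (≤-trans Σ≤ (+-monoˡ-≤ (Σ′ (u ∘ suc)) (u≤v zero)))) s

-- Compared with the identity on `S`, no fibre of `π` is smaller and the total is the same, so every
-- fibre over `S` has one element.
surjective⇒injective : {S : Subset d} {π : Fin d → Fin d} → (∀ {c} → c ∈ S → ∃ λ b → b ∈ S × π b ≡ c) →
  (∀ {c} → c ∈ S → π c ∈ S) → ∀ {b c} → b ∈ S → c ∈ S → π b ≡ π c → b ≡ c
surjective⇒injective {S = S} {π} onto maps {b} {c} b∈ c∈ e = decidable-stable (b ≟ c) λ b≢c →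
  <⇒≱ (2≤∣∣ (∈-fibre⁺ {t = π} c∈ refl) (∈-fibre⁺ b∈ e) b≢c)
    (≤-trans (Σ′-squeeze id≤π (≤-reflexive (trans (sym (∣K∣≡Σcnt S π)) (∣K∣≡Σcnt S (λ s → s)))) (π c))
      (≤-reflexive (∣∣≡1⁺ (∈-fibre⁺ (maps c∈) refl) λ z∈ → proj₂ (∈-fibre⁻ z∈))))
  where
  id≤π : ∀ r → cnt S (λ s → s) r ≤ cnt S π r
  id≤π r with r ∈? S
  ... | yes r∈ = ≤-trans (≤-reflexive (∣∣≡1⁺ (∈-fibre⁺ r∈ refl) λ z∈ → proj₂ (∈-fibre⁻ z∈)))
    (let _ , b∈ , πb = onto r∈ in ∈⇒1≤∣∣ (∈-fibre⁺ b∈ πb))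
  ... | no r∉ = p⊆q⇒∣p∣≤∣q∣ {p = fibre S (λ s → s) r} {fibre S π r} λ z∈ →
    let z∈S , z≡r = ∈-fibre⁻ z∈ in contradiction (subst (_∈ S) z≡r z∈S) r∉

-- A set S in which every node c has an incoming arc f (ζ c) → g (ζ c) = c from another
-- node of S contains a directed cycle, that is, a set on which f and g are different matchings.
no-closed-set : {f g : Fin n → Fin d} → CompatibleOn Full f Full g →
  ∀ k {S : Subset d} {ζ : Fin d → Fin n} → ∣ S ∣ ≡ k →
  (∀ {c} → c ∈ S → g (ζ c) ≡ c × f (ζ c) ∈ S × f (ζ c) ≢ c) → ∀ {c} → c ∉ S
no-closed-set comp zero ∣S∣ _ c∈ = contradiction (subst (1 ≤_) ∣S∣ (∈⇒1≤∣∣ c∈)) λ ()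
no-closed-set {n} {d} {f} {g} comp (suc k) {S} {ζ} ∣S∣ closed {c₀} c₀∈
  with any? (λ c → (c ∈? S) ×-dec ¬? (any? λ b → (b ∈? S) ×-dec (f (ζ b) ≟ c)))
... | yes (c , c∈ , none) = no-closed-set comp k (∣∖∣-pred c∈ ∣S∣)
        (λ b∈ → let gb , fb∈ , fb≢ = closed (∖⊆ b∈) in gb , ∈-∖ fb∈ (λ fb → none (_ , ∖⊆ b∈ , fb)) , fb≢)
        (∈-∖ (proj₁ (proj₂ (closed c∈))) (proj₂ (proj₂ (closed c∈))))
-- Now the map sending `b` to `f (ζ b)` permutes `S`, so `f` and `g` both match `J`, the image of
-- `S` under `ζ`, with `S`, and yet they differ on it.
... | no all-hit = proj₂ (proj₂ (closed c₀∈))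
  (trans (comp (λ _ → ∈⊤) (λ _ → ∈⊤) bij-f bij-g (ζ∈ c₀∈)) (proj₁ (closed c₀∈)))
  where
  J? : ∀ z → Dec (g z ∈ S × ζ (g z) ≡ z)
  J? z = (g z ∈? S) ×-dec (ζ (g z) ≟ z)
  J = sep J?
  ζ∈ : ∀ {c} → c ∈ S → ζ c ∈ J
  ζ∈ c∈ = let gc , _ = closed c∈ in ∈-sep⁺ J? (subst (_∈ S) (sym gc) c∈ , cong ζ gc)
  hit : ∀ {c} → c ∈ S → ∃ λ b → b ∈ S × f (ζ b) ≡ c
  hit {c} c∈ with any? (λ b → (b ∈? S) ×-dec (f (ζ b) ≟ c))
  ... | yes h = h
  ... | no none = contradiction (c , c∈ , none) all-hit
  J∋ : ∀ {z} → z ∈ J → g z ∈ S × ζ (g z) ≡ z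
  J∋ = ∈-sep⁻ J?
  bij-g : Bijective J g S
  bij-g = record { maps = λ z∈ → proj₁ (J∋ z∈)
    ; injective = λ y∈ z∈ e → trans (sym (proj₂ (J∋ y∈))) (trans (cong ζ e) (proj₂ (J∋ z∈)))
    ; surjective = λ c∈ → ζ _ , ζ∈ c∈ , proj₁ (closed c∈) }
  bij-f : Bijective J f S
  bij-f = record { maps = λ {z} z∈ → subst (λ y → f y ∈ S) (proj₂ (J∋ z∈)) (proj₁ (proj₂ (closed (proj₁ (J∋ z∈)))))
    ; injective = λ {y} {z} y∈ z∈ e → Bijective.injective bij-g y∈ z∈
        (surjective⇒injective {π = λ c → f (ζ c)} hit (λ c∈ → proj₁ (proj₂ (closed c∈)))
          (proj₁ (J∋ y∈)) (proj₁ (J∋ z∈))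
          (trans (cong f (proj₂ (J∋ y∈))) (trans e (cong f (sym (proj₂ (J∋ z∈)))))))
    ; surjective = λ c∈ → let b , b∈ , fb = hit c∈ in ζ b , ζ∈ b∈ , fb }

-- The nodes entered by a non-loop arc f z → g z are closed under predecessors: only at i can
-- the arcs leaving a node outnumber those entering it, and z₀ itself would enter i.
no-arc-into-excess : {f g : Fin n → Fin d} {K : Subset n} {u : Fin d → ℕ} {i j : Fin d} →
  CompatibleOn Full f Full g → HasType K f (bump u i) → HasType K g (bump u j) → ∀ {z} → z ∈ K → g z ≡ i → f z ≡ i
no-arc-into-excess {n} {d} {f} {g} {K} {u} {i} {j} comp tf tg {z₀} z₀∈ gz₀ =
  decidable-stable (f z₀ ≟ i) λ fz₀≢ →
    no-closed-set comp _ {S} {proj₁ ζ} refl (closed fz₀≢) (∈-sep⁺ S? (z₀ , z₀∈ , gz₀ , fz₀≢))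
  where
  Entered : Fin d → Set
  Entered c = ∃ λ z → z ∈ K × g z ≡ c × f z ≢ c
  S? : ∀ c → Dec (Entered c)
  S? c = any? λ z → (z ∈? K) ×-dec ((g z ≟ c) ×-dec ¬? (f z ≟ c))
  S = sep S?
  ζ = choose {P = λ c z → z ∈ K × g z ≡ c × f z ≢ c} S z₀ λ c c∈ → ∈-sep⁻ S? c∈
  -- Away from `i` the `g`-fibre is at least as large as the `f`-fibre, so it has an element `y`
  -- outside the latter without `z`; its arc enters `f z` and is no loop.
  predecessor : ∀ {z} → z ∈ K → g z ≢ f z → f z ≢ i → Entered (f z)
  predecessor {z} z∈ g≢f f≢i with outsider (fibre K g (f z)) (fibre K f (f z) ∖ z)
    (≤-trans (≤-reflexive (trans (sym (∣∖∣ (fibre K f (f z)) (∈-fibre⁺ z∈ refl)))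
      (trans (tf (f z)) (bump-other u (f≢i ∘ sym)))))
      (≤-trans (u≤bump u j (f z)) (≤-reflexive (sym (tg (f z))))))
  ... | y , y∈ , y∉ with ∈-fibre⁻ y∈
  ... | y∈K , gy = y , y∈K , gy , λ fy → y∉ (∈-∖ (∈-fibre⁺ y∈K fy) λ { refl → g≢f gy })
  closed : f z₀ ≢ i → ∀ {c} → c ∈ S → g (proj₁ ζ c) ≡ c × f (proj₁ ζ c) ∈ S × f (proj₁ ζ c) ≢ c
  closed fz₀≢ {c} c∈ with proj₂ ζ c∈
  ... | z∈ , gz , fz with f (proj₁ ζ c) ≟ i
  ...   | no f≢i = gz , ∈-sep⁺ S? (predecessor z∈ (λ e → fz (trans (sym e) gz)) f≢i) , fz
  ...   | yes f≡i = gz , subst (_∈ S) (sym f≡i) (∈-sep⁺ S? (z₀ , z₀∈ , gz₀ , fz₀≢)) , fz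

-- Acyclicity from rank functions

adj-sym : {E : ERel n d} {u w : Vertex n d} → Adj E u w → Adj E w u
adj-sym {u = inj₁ _} {inj₂ _} e = e
adj-sym {u = inj₂ _} {inj₁ _} e = e

module Ranked {E : ERel n d} (ρ : Vertex n d → ℕ)
  (strict : ∀ {u w} → Adj E u w → ρ u < ρ w ⊎ ρ w < ρ u)
  (unique-lower : ∀ {u w w′} → Adj E u w → Adj E u w′ → ρ w < ρ u → ρ w′ < ρ u → w ≡ w′) where

  V = Vertex n d

  NonBacktracking : List V → Set
  NonBacktracking (u ∷ w ∷ x ∷ xs) = u ≢ x × NonBacktracking (w ∷ x ∷ xs)
  NonBacktracking _ = ⊤

  Up Down : V → V → Set
  Up u w = ρ u < ρ w
  Down u w = ρ w < ρ u

  -- After a step up, `u` is the only lower neighbour of `w`, so going on without turning back means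
  -- going up again.
  ascending : ∀ {u w xs} → Chain E (u ∷ w ∷ xs) → NonBacktracking (u ∷ w ∷ xs) → Up u w → LinkedList Up (u ∷ w ∷ xs)
  ascending {xs = []} _ _ up = up ∷ [-]
  ascending {u} {w} {xs = x ∷ xs} (cons uw ch@(cons wx _)) (u≢x , nb) up with strict wx
  ... | inj₁ up′ = up ∷ ascending ch nb up′
  ... | inj₂ down = contradiction (unique-lower (adj-sym {u = u} {w} uw) wx up down) u≢x

  LastDown : List V → Set
  LastDown (u ∷ w ∷ []) = Down u w
  LastDown (_ ∷ w ∷ x ∷ xs) = LastDown (w ∷ x ∷ xs)
  LastDown _ = ⊤

  descending : ∀ {u w xs} → Chain E (u ∷ w ∷ xs) → NonBacktracking (u ∷ w ∷ xs) → LastDown (u ∷ w ∷ xs) →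
    LinkedList Down (u ∷ w ∷ xs)
  descending {xs = []} _ _ down = down ∷ [-]
  descending {u} {w} {xs = x ∷ xs} (cons uw ch@(cons wx _)) (u≢x , nb) last
    with descending ch nb last | strict uw
  ... | rest@(down ∷ _) | inj₂ down′ = down′ ∷ rest
  ... | rest@(down ∷ _) | inj₁ up = contradiction (unique-lower (adj-sym {u = u} {w} uw) wx up down) u≢x

  last-down : ∀ xs {v a} → Down v a → LastDown (xs ++ v ∷ a ∷ [])
  last-down [] down = down
  last-down (_ ∷ []) down = down
  last-down (_ ∷ _ ∷ []) down = down
  last-down (_ ∷ x ∷ y ∷ xs) down = last-down (x ∷ y ∷ xs) down

  chain-snoc : ∀ xs {v a} → Chain E (xs ++ [ v ]) → Adj E v a → Chain E (xs ++ v ∷ a ∷ [])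
  chain-snoc [] _ va = cons va one
  chain-snoc (x ∷ []) (cons xv _) va = cons xv (cons va one)
  chain-snoc (x ∷ y ∷ xs) (cons xy ch) va = cons xy (chain-snoc (y ∷ xs) ch va)

  non-backtracking : ∀ {v a} b ys → UniqueList (b ∷ ys) → All (v ≢_) (b ∷ ys) → All (a ≢_) (b ∷ ys) →
    NonBacktracking (b ∷ ys ++ v ∷ a ∷ [])
  non-backtracking b [] _ _ (a≢b ∷ _) = a≢b ∘ sym , tt
  non-backtracking b (y ∷ []) (_ ∷ uq) (v≢b ∷ v≢) (_ ∷ a≢) = v≢b ∘ sym , non-backtracking y [] uq v≢ a≢
  non-backtracking b (y ∷ z ∷ ys) ((_ ∷ b≢z ∷ _) ∷ uq) (_ ∷ v≢) (_ ∷ a≢) = b≢z , non-backtracking y (z ∷ ys) uq v≢ a≢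

  -- Going around the cycle twice at v: if the first step goes up then so do all steps,
  -- and if it goes down then, read backwards, all steps do.
  no-cycle : ¬ HasCycle E
  no-cycle (v , a ∷ [] , s≤s () , _)
  no-cycle (v , a ∷ b ∷ ys , _ , (v≢a ∷ v≢b ∷ v≢) ∷ (a≢b ∷ a≢) ∷ uq , ch@(cons va _)) = absurd (strict va)
    where
    walk = v ∷ a ∷ b ∷ ys ++ v ∷ a ∷ []
    walk-chain : Chain E walk
    walk-chain = chain-snoc (v ∷ a ∷ b ∷ ys) ch va
    a≢next : ∀ zs → All (a ≢_) zs →
      NonBacktracking (b ∷ zs ++ v ∷ a ∷ []) → NonBacktracking (a ∷ b ∷ zs ++ v ∷ a ∷ [])
    a≢next [] _ nb = v≢a ∘ sym , nb
    a≢next (z ∷ zs) (a≢z ∷ _) nb = a≢z , nb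
    nb : NonBacktracking walk
    nb = v≢b , a≢next ys a≢ (non-backtracking b ys uq (v≢b ∷ v≢) (a≢b ∷ a≢))
    v∈ : v ∈ₗ a ∷ b ∷ ys ++ v ∷ a ∷ []
    v∈ = ∈-++⁺ʳ (a ∷ b ∷ ys) (here refl)
    absurd : ρ v < ρ a ⊎ ρ a < ρ v → ⊥
    absurd (inj₁ up) with Linked⇒AllPairs <-trans (ascending walk-chain nb up)
    ... | v< ∷ _ = <-irrefl refl (All.lookup v< v∈)
    absurd (inj₂ down) with Linked⇒AllPairs (λ p q → <-trans q p)
      (descending walk-chain nb (last-down (v ∷ a ∷ b ∷ ys) down))
    ... | v> ∷ _ = <-irrefl refl (All.lookup v> v∈)

-- The tree of a linked set of size d + 1

module LinkedToTree {n d : ℕ} (m : Subset n → Fin n → Fin d)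
  (m-onto : ∀ {σ} → ∣ σ ∣ ≡ d → Onto σ (m σ))
  (𝓜 : Subset n → Graph n d) (represents : ∀ {σ} → ∣ σ ∣ ≡ d → Represents (𝓜 σ) σ (m σ))
  {τ : Subset n} (∣τ∣ : ∣ τ ∣ ≡ suc d) (linked : Topes.Linked m m-onto τ) where

  open Topes m m-onto

  ones : Fin d → ℕ
  ones _ = 1

  1≤ones : ∀ s → 1 ≤ ones s
  1≤ones _ = ≤-refl

  amalgam : ∀ q → ∃ (Amalgam τ ones q)
  amalgam q = linked ones 1≤ones (trans ∣τ∣ (cong suc (sym (Σ′-one {d})))) q

  T : Fin d → Fin n → Fin d
  T q = proj₁ (amalgam q)

  T-tope : ∀ q → Tope τ (T q) (bump ones q)
  T-tope q = proj₁ (proj₂ (amalgam q))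

  size : ∀ {x} → x ∈ τ → ∣ τ ∖ x ∣ ≡ d
  size x∈ = ∣∖∣-pred x∈ ∣τ∣

  m-tope : ∀ {x} → x ∈ τ → Tope (τ ∖ x) (m (τ ∖ x)) ones
  m-tope {x} x∈ = good-base (size x∈) , 
    Σ≡d⇒all-one _ (good-pos (good-base (size x∈))) (trans (sym (∣K∣≡Σcnt (τ ∖ x) (m (τ ∖ x)))) (size x∈))

  T≡m : ∀ {x q} → x ∈ τ → T q x ≡ q → ∀ {z} → z ∈ τ ∖ x → T q z ≡ m (τ ∖ x) z
  T≡m {x} {q} x∈ Tx = base-agree (size x∈) (proj₁ (tope-del 1≤ones x∈ Tx (T-tope q))) (good-base (size x∈))

  m⇒T : ∀ {x z q} → x ∈ τ → z ∈ τ ∖ x → m (τ ∖ x) z ≡ q → T q z ≡ q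
  m⇒T {q = q} x∈ = proj₂ (proj₂ (amalgam q)) x∈ (m-tope x∈)

  U : ERel n d
  U = UnionBelow 𝓜 τ

  -- Two elements lie over `q` in `T q`; deleting the one other than `z` leaves a matching of the
  -- field. With `U⁻`, this identifies the neighbours of `q` in the union with that fibre.
  U⁺ : ∀ {z q} → z ∈ τ → T q z ≡ q → U z q
  U⁺ {z} {q} z∈ Tz with fibre-elt {K = τ ∖ z} {T q} {q} (good-pos (proj₁ (tope-del 1≤ones z∈ Tz (T-tope q))) q)
  ... | x , x∈ , Tx = τ ∖ x , ∖⊆ , size x∈τ ,
          subst (Edge (𝓜 (τ ∖ x)) z) (trans (sym (T≡m x∈τ Tx z∈′)) Tz)
            (Represents.edge (represents (size x∈τ)) z∈′)
    where
    x∈τ = ∖⊆ x∈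
    z∈′ = ∈-∖ z∈ (∈∖⇒≢ x∈ ∘ sym)

  U⁻ : ∀ {z q} → U z q → z ∈ τ × T q z ≡ q
  U⁻ {z} {q} (σ , σ⊆ , ∣σ∣ , e) with outsider τ σ (≤-reflexive (trans (cong suc ∣σ∣) (sym ∣τ∣)))
  ... | x , x∈ , x∉ = σ⊆ z∈σ ,
    m⇒T x∈ (σ⊆′ z∈σ) (trans (cong (λ R → m R z) (sym σ≡)) (Represents.value (represents ∣σ∣) e))
    where
    z∈σ = Represents.domain (represents ∣σ∣) e
    σ⊆′ : σ ⊆ τ ∖ x
    σ⊆′ z∈ = ∈-∖ (σ⊆ z∈) λ { refl → x∉ z∈ }
    σ≡ : σ ≡ τ ∖ x
    σ≡ = ⊆-antisym σ⊆′ (same-size σ⊆′ (trans ∣σ∣ (sym (size x∈))))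

  module Rooted {x : Fin n} (x∈ : x ∈ τ) where

    f : Fin n → Fin d
    f = m (τ ∖ x)

    distance : Fin d → ℕ
    distance q = ∣ mismatch (τ ∖ x) (T q) f ∣

    -- Off `z` both `T q` and `T (f z)` are the matching of `τ ∖ z`, and at `z` the latter agrees
    -- with `f`.
    parent-closer : ∀ {z q} → z ∈ τ → T q z ≡ q → z ≢ x → f z ≢ q → distance (f z) < distance q
    parent-closer {z} {q} z∈ Tz z≢x fz≢q = p⊂q⇒∣p∣<∣q∣
      ((λ {y} → sub {y}) , z , ∈-mismatch⁺ z∈′ (λ e → fz≢q (trans (sym e) Tz)) ,
      λ z∈m → proj₂ (∈-mismatch⁻ z∈m) T′z)
      where
      z∈′ = ∈-∖ z∈ z≢x
      T′z : T (f z) z ≡ f z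
      T′z = m⇒T x∈ z∈′ refl
      sub : mismatch (τ ∖ x) (T (f z)) f ⊆ mismatch (τ ∖ x) (T q) f
      sub {y} y∈m with ∈-mismatch⁻ y∈m
      ... | y∈ , T′y = ∈-mismatch⁺ y∈ λ Ty → T′y (trans (T≡m z∈ T′z y∈z) (trans (sym (T≡m z∈ Tz y∈z)) Ty))
        where y∈z = ∈-∖ (∖⊆ y∈) λ { refl → T′y T′z }

    -- The fibre of `T q` over `q` has two elements, and one of them is the child that `f` matches
    -- to `q`.
    only-parent : ∀ {y z q} → y ∈ τ → T q y ≡ q → ¬ (y ≢ x × f y ≡ q) →
      z ∈ τ → T q z ≡ q → ¬ (z ≢ x × f z ≡ q) → y ≡ z
    only-parent {q = q} y∈ Ty y-up z∈ Tz z-up = at-most-one-outside {p = fibre τ (T q) q} {children} {children}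
      (λ w∈ → let w∈x , fw = ∈-fibre⁻ w∈ in ∈-fibre⁺ (∖⊆ w∈x) (m⇒T x∈ w∈x fw)) (λ w∈ → w∈)
      (trans (proj₂ (T-tope q) q) (trans (bump-same ones q) (cong suc (sym (proj₂ (m-tope x∈) q)))))
      (∈-fibre⁺ y∈ Ty) (λ y∈c → let y∈x , fy = ∈-fibre⁻ y∈c in y-up (∈∖⇒≢ y∈x , fy))
      (∈-fibre⁺ z∈ Tz) (λ z∈c → let z∈x , fz = ∈-fibre⁻ z∈c in z-up (∈∖⇒≢ z∈x , fz))
      where children = fibre (τ ∖ x) f q

    -- Doubling leaves room for a left node between its parent and its children.
    ρ : Vertex n d → ℕ
    ρ (inj₁ z) with z ≟ x
    ... | yes _ = 0
    ... | no _ = 2 + (distance (f z) + distance (f z))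
    ρ (inj₂ q) = suc (distance q + distance q)

    up-edge : ∀ {z q} → ¬ (z ≢ x × f z ≡ q) → U z q → ρ (inj₁ z) < ρ (inj₂ q)
    up-edge {z} {q} up e with z ≟ x
    ... | yes _ = s≤s z≤n
    ... | no z≢x = s≤s (≤-trans (s≤s (≤-reflexive (sym (+-suc (distance (f z)) _)))) (+-mono-≤ closer closer))
      where
      closer = parent-closer (proj₁ (U⁻ e)) (proj₂ (U⁻ e)) z≢x λ fz → up (z≢x , fz)

    down-edge : ∀ {z q} → z ≢ x × f z ≡ q → ρ (inj₂ q) < ρ (inj₁ z)
    down-edge {z} (z≢x , refl) with z ≟ x
    ... | yes z≡x = contradiction z≡x z≢x
    ... | no _ = ≤-refl

    child? : ∀ z q → Dec (z ≢ x × f z ≡ q)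
    child? z q = ¬? (z ≟ x) ×-dec (f z ≟ q)

    below⇒child : ∀ {z q} → U z q → ρ (inj₂ q) < ρ (inj₁ z) → z ≢ x × f z ≡ q
    below⇒child {z} {q} e lt with child? z q
    ... | yes c = c
    ... | no up = contradiction (up-edge up e) (<-asym lt)

    above⇒parent : ∀ {z q} → ρ (inj₁ z) < ρ (inj₂ q) → ¬ (z ≢ x × f z ≡ q)
    above⇒parent lt c = <-asym lt (down-edge c)

    strict-edge : ∀ {z q} → U z q → ρ (inj₁ z) < ρ (inj₂ q) ⊎ ρ (inj₂ q) < ρ (inj₁ z)
    strict-edge {z} {q} e with child? z q
    ... | yes c = inj₂ (down-edge c)
    ... | no up = inj₁ (up-edge up e)

    strict : ∀ {u w} → Adj U u w → ρ u < ρ w ⊎ ρ w < ρ u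
    strict {inj₁ _} {inj₂ _} e = strict-edge e
    strict {inj₂ _} {inj₁ _} e = [ inj₂ , inj₁ ]′ (strict-edge e)

    unique-lower : ∀ {u w w′} → Adj U u w → Adj U u w′ → ρ w < ρ u → ρ w′ < ρ u → w ≡ w′
    unique-lower {inj₁ _} {inj₂ _} {inj₂ _} e e′ lt lt′ = cong inj₂
      (trans (sym (proj₂ (below⇒child e lt))) (proj₂ (below⇒child e′ lt′)))
    unique-lower {inj₂ _} {inj₁ y} {inj₁ z} e e′ lt lt′ = cong inj₁
      (only-parent (proj₁ (U⁻ e)) (proj₂ (U⁻ e)) (above⇒parent {y} lt)
        (proj₁ (U⁻ e′)) (proj₂ (U⁻ e′)) (above⇒parent {z} lt′))

    acyclic : ¬ HasCycle U
    acyclic = Ranked.no-cycle ρ (λ {u} {w} → strict {u} {w}) (λ {u} {w} {w′} → unique-lower {u} {w} {w′})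

    right-to-root : ∀ D q → distance q < D → Reach U (inj₂ q) (inj₁ x)
    right-to-root (suc D) q (s≤s ≤D) with T q x ≟ q
    ... | yes Tx = step (U⁺ x∈ Tx) here
    ... | no Tx≢q with outsider (fibre τ (T q) q) (fibre (τ ∖ x) f q)
        (≤-reflexive (trans (cong suc (proj₂ (m-tope x∈) q)) (sym (trans (proj₂ (T-tope q) q) (bump-same ones q)))))
    ... | y , y∈ , y∉ with ∈-fibre⁻ y∈
    ... | y∈τ , Ty = step {w = inj₁ y} (U⁺ y∈τ Ty) (step (U⁺ y∈τ (m⇒T x∈ y∈x refl))
            (right-to-root D (f y) (≤-trans (parent-closer y∈τ Ty y≢x λ fy → y∉ (∈-fibre⁺ y∈x fy)) ≤D)))
      where
      y≢x : y ≢ x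
      y≢x refl = Tx≢q Ty
      y∈x = ∈-∖ y∈τ y≢x

    to-root : ∀ u → InVS τ Full u → Reach U u (inj₁ x)
    to-root (inj₂ q) _ = right-to-root _ q ≤-refl
    to-root (inj₁ z) z∈ with z ≟ x
    ... | yes refl = here
    ... | no z≢x = step (U⁺ z∈ (m⇒T x∈ (∈-∖ z∈ z≢x) refl)) (right-to-root _ (f z) ≤-refl)

  reach-trans : ∀ {u v w} → Reach U u v → Reach U v w → Reach U u w
  reach-trans here q = q
  reach-trans (step e p) q = step e (reach-trans p q)

  reach-sym : ∀ {u v} → Reach U u v → Reach U v u
  reach-sym here = here
  reach-sym {u} (step {w = w} e p) = reach-trans (reach-sym p) (step (adj-sym {u = u} {w} e) here)

  tree : IsTreeOn U τ Full
  tree = (λ i j e → proj₁ (U⁻ e) , ∈⊤) , connected root , acyclic root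
    where
    root : ∃ λ x → x ∈ τ
    root = inhabited (subst (1 ≤_) (sym ∣τ∣) (s≤s z≤n))
    connected : (∃ λ x → x ∈ τ) → ∀ u v → InVS τ Full u → InVS τ Full v → Reach U u v
    connected (x , x∈) u v u∈ v∈ = reach-trans (Rooted.to-root x∈ u u∈) (reach-sym (Rooted.to-root x∈ v v∈))
    acyclic : (∃ λ x → x ∈ τ) → ¬ HasCycle U
    acyclic (x , x∈) = Rooted.acyclic x∈

-- The matching field of an arrangement

module ArrangementToField {n d : ℕ} (r₀ : Fin d) (d≤n : d ≤ n) (𝓐 : Graph n d → Set)
  (arrangement : IsTopeArrangement n d 𝓐) where

  Member : (Fin n → Fin d) → Set
  Member t = Σ (Graph n d) λ T → 𝓐 T × Represents T Full t

  member-represents : ∀ {T} → 𝓐 T → Represents T Full (function r₀ T)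
  member-represents {T} a = proj₁ (maximal⁻ r₀ {T = T} (proj₁ arrangement T a))

  members-compatible : ∀ {t t′} → Member t → Member t′ → CompatibleOn Full t Full t′
  members-compatible (T , a , r) (T′ , a′ , r′) = compatible⁻ r r′ (proj₁ (proj₂ arrangement) T T′ a a′)

  -- Deleting left nodes only restricts where types are counted: members stay topes on all of L, so
  -- their compatibility remains at hand.
  Complete : Subset n → Set
  Complete K = ∀ u → (∀ s → 1 ≤ u s) → ∣ K ∣ ≡ Σ′ u → Σ (Fin n → Fin d) λ t → Member t × HasType K t u

  complete-full : Complete Full
  complete-full u 1≤u e with proj₂ (proj₂ (proj₂ (proj₂ arrangement))) (tabulate λ s → u s ∸ 1)
    (trans (sym (m+n∸m≡n d _)) (cong (_∸ d) (trans (Σ′-∸1 1≤u) (trans (sym e) (∣⊤∣≡n n)))))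
  ... | T , a , w≡ = function r₀ T , (T , a , r) , λ s → trans (sym (rdeg≡cnt r s))
      (∸-cancelʳ-≡ (proj₂ (proj₁ arrangement T a) s) (1≤u s)
        (trans (sym (minusOnes-lookup T s)) (trans (cong (λ v → lookup v s) w≡) (lookup∘tabulate _ s))))
    where r = member-represents a

  -- Let `t` be a member of type `u` + e_s on `K` for any `s`, here `r₀`. The member `t′` with
  -- excess at `t x` instead must also send `x` to `t x`, since no non-loop arc enters the excess
  -- node. Deleting `x` from `t′` leaves type `u`.
  complete-del : ∀ {K x} → x ∈ K → Complete K → Complete (K ∖ x)
  complete-del {K} {x} x∈ complete u 1≤u e = finish (at r₀)
    where
    at : ∀ r → Σ (Fin n → Fin d) λ t → Member t × HasType K t (bump u r)
    at r = complete (bump u r) (λ s → ≤-trans (1≤u s) (u≤bump u r s))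
      (trans (∣∖∣ K x∈) (trans (cong suc e) (sym (Σ′-bump u r))))
    finish : (Σ (Fin n → Fin d) λ t → Member t × HasType K t (bump u r₀)) →
      Σ (Fin n → Fin d) λ t → Member t × HasType (K ∖ x) t u
    finish (t , a , ty) with at (t x)
    ... | t′ , a′ , ty′ = t′ , a′ , type-del {t = t′} x∈
      (no-arc-into-excess (members-compatible a′ a) ty′ ty x∈ refl) ty′

  complete : ∀ K → Complete K
  complete = deletion-induction Complete complete-full complete-del

  ones : Fin d → ℕ
  ones _ = 1

  on-basis : ∀ {σ} → ∣ σ ∣ ≡ d → Σ (Fin n → Fin d) λ t → Member t × HasType σ t ones
  on-basis {σ} ∣σ∣ = complete σ ones (λ _ → ≤-refl) (trans ∣σ∣ (sym (Σ′-one {d})))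

  abstract
    -- Only d-subsets matter; elsewhere m takes the junk value r₀.
    m : Subset n → Fin n → Fin d
    m σ with ∣ σ ∣ ≟ℕ d
    ... | yes ∣σ∣ = proj₁ (on-basis {σ} ∣σ∣)
    ... | no _ = λ _ → r₀

    m-member : ∀ {σ} → ∣ σ ∣ ≡ d → Member (m σ) × HasType σ (m σ) ones
    m-member {σ} ∣σ∣ with ∣ σ ∣ ≟ℕ d
    ... | yes e = proj₂ (on-basis {σ} e)
    ... | no ne = contradiction ∣σ∣ ne

  m-onto : ∀ {σ} → ∣ σ ∣ ≡ d → Onto σ (m σ)
  m-onto {σ} ∣σ∣ r = fibre-elt {K = σ} {m σ} (≤-reflexive (sym (proj₂ (m-member ∣σ∣) r)))

  member≡m : ∀ {σ t} → ∣ σ ∣ ≡ d → Member t → Onto σ t → ∀ {z} → z ∈ σ → m σ z ≡ t z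
  member≡m ∣σ∣ a on = members-compatible (proj₁ (m-member ∣σ∣)) a (λ _ → ∈⊤) (λ _ → ∈⊤)
    (onto⇒bijective ∣σ∣ (m-onto ∣σ∣)) (onto⇒bijective ∣σ∣ on)

  𝓜 : Subset n → Graph n d
  𝓜 σ = graphOf σ (m σ)

  open Topes m m-onto

  -- The member of type `u` + e_r on `τ` is the amalgam. As `m (τ ∖ x)` is itself a member, its
  -- value at `x` is meaningful and gives it type `u` + e_q on `τ` for some `q`; so
  -- `no-arc-into-excess` yields absorption.
  linked-at : ∀ {τ} → ∣ τ ∣ ≡ suc d → Linked τ
  linked-at {τ} ∣τ∣ u 1≤u e r
    with complete τ (bump u r) (λ s → ≤-trans (1≤u s) (u≤bump u r s)) (trans e (sym (Σ′-bump u r)))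
  ... | T , a , ty = T , (good on-T (λ _ ∣σ∣ → member≡m ∣σ∣ a) , ty) , absorbs
    where
    on-T : Onto τ T
    on-T s = fibre-elt {K = τ} {T} (subst (1 ≤_) (sym (ty s)) (≤-trans (1≤u s) (u≤bump u r s)))
    absorbs : Absorbs τ u r T
    absorbs {x} {f} x∈ F {z} z∈ fz = no-arc-into-excess (members-compatible a (proj₁ mm)) ty
      (type-add {t = m (τ ∖ x)} x∈ refl λ s → trans (proj₂ mm s) (sym (u≡1 s)))
      (∖⊆ z∈) (trans (base-agree ∣τ∖x∣ (good-base ∣τ∖x∣) (proj₁ F) z∈) fz)
      where
      ∣τ∖x∣ : ∣ τ ∖ x ∣ ≡ d
      ∣τ∖x∣ = ∣∖∣-pred x∈ ∣τ∣
      mm = m-member ∣τ∖x∣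
      u≡1 : ∀ s → u s ≡ 1
      u≡1 = Σ≡d⇒all-one u 1≤u (suc-injective (trans (sym e) ∣τ∣))

  𝓜-matching : ∀ {σ} → ∣ σ ∣ ≡ d → IsPerfectMatchingOn (𝓜 σ) σ Full
  𝓜-matching {σ} ∣σ∣ = matching⁺ (graphOf-represents σ (m σ)) (onto⇒bijective ∣σ∣ (m-onto ∣σ∣))

  𝓜-in : (σ : Subset n) → ∣ σ ∣ ≡ d → InArrangementPM 𝓐 σ (𝓜 σ)
  𝓜-in σ ∣σ∣ with proj₁ (m-member ∣σ∣)
  ... | T , a , r = 𝓜-matching ∣σ∣ , T , a , represents-⊆ (graphOf-represents σ (m σ)) r λ _ → ∈⊤ , refl

  𝓜-unique : (σ : Subset n) → ∣ σ ∣ ≡ d → (M : Graph n d) → InArrangementPM 𝓐 σ M → M ≡ 𝓜 σ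
  𝓜-unique σ ∣σ∣ M (pm , T , a , M⊆) with matching⁻ r₀ pm
  ... | rM , bM = represents-≡ rM (graphOf-represents σ (m σ)) λ z∈ → trans (sym (t≡M z∈))
      (sym (member≡m ∣σ∣ (T , a , rT)
        (λ r → let i , i∈ , Mi = Bijective.surjective bM ∈⊤ in i , i∈ , trans (t≡M i∈) Mi) z∈))
    where
    rT = member-represents a
    t≡M : ∀ {z} → z ∈ σ → function r₀ T z ≡ function r₀ M z
    t≡M z∈ = proj₂ (⊆G-agree rM rT M⊆ z∈)

  linkage : IsLinkageMatchingField 𝓜
  linkage = (λ σ → 𝓜-matching) , λ τ ∣τ∣ →
    LinkedToTree.tree m m-onto 𝓜 (λ {σ} _ → graphOf-represents σ (m σ)) ∣τ∣ (linked-at ∣τ∣)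

theorem3p32 : (n d : ℕ) → 1 ≤ d → d ≤ n →
    ((𝓜 : Subset n → Graph n d) → IsLinkageMatchingField 𝓜 →
    IsTopeArrangement n d (CompatibleTopes 𝓜))
    ×
    ((𝓐 : Graph n d → Set) → IsTopeArrangement n d 𝓐 →
    ((σ : Subset n) → ∣ σ ∣ ≡ d →
    Σ (Graph n d) λ M → InArrangementPM 𝓐 σ M ×
    ((M′ : Graph n d) → InArrangementPM 𝓐 σ M′ → M′ ≡ M))
    ×
    Σ (Subset n → Graph n d) λ 𝓜 →
    ((σ : Subset n) → ∣ σ ∣ ≡ d → InArrangementPM 𝓐 σ (𝓜 σ)) ×
    IsLinkageMatchingField 𝓜)
theorem3p32 n (suc d) 1≤d d≤n =
  -- Since `d` is positive, `zero` serves as the default right node.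
  (λ 𝓜 (field-𝓜 , linkage) → FieldToArrangement.arrangement zero d≤n 𝓜 field-𝓜 linkage) ,
  λ 𝓐 arrangement → let open ArrangementToField zero d≤n 𝓐 arrangement in
    (λ σ ∣σ∣ → 𝓜 σ , 𝓜-in σ ∣σ∣ , 𝓜-unique σ ∣σ∣) , 𝓜 , 𝓜-in , linkage
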